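{- Work in $\mathsf{ZF}$. Then $\mathsf{DC_{\aleph_{1}}}$ implies $\mathsf{EDM}$. Moreover, $\mathsf{W_{\aleph_{1}}}$ together with "$\aleph_1$ is regular" implies $\mathsf{EDM}$.
   Context: For sets $X,Y$, $|X|\le|Y|$ means there is an injection $X\to Y$. A set $X$ is countable if $|X|\le\aleph_0$, and uncountable if there is no injection from $X$ into $\omega$. "Countably infinite" means in bijection with $\omega$. $[V]^2$ denotes the set of 2-element subsets of $V$. For a coloring $f:[V]^2\to k$, a set $S\subseteq V$ is monochromatic in color $i$ if $f(\{x,y\})=i$ for all distinct $x,y\in S$. $\mathsf{EDM}$: If $G=(V_G,E_G)$ is a graph such that $V_G$ is uncountable, then for every coloring $f:[V_G]^2\to\{0,1\}$ either there is an uncountable set monochromatic in color $0$, or there is a countably infinite set monochromatic in color $1$. $\mathsf{DC_{\aleph_1}}$: Let $S$ be a non-empty set and $R$ a binary relation such that for every $\beta<\aleph_1$ and every $\beta$-sequence $s=(s_\epsilon)_{\epsilon<\beta}$ of elements of $S$ there is $y\in S$ with $sRy$. Then there is $f:\aleph_1\to S$ with $(f\restriction\beta)\,R\,f(\beta)$ for all $\beta<\aleph_1$. $\mathsf{W_{\aleph_1}}$: For every set $X$, either $|X|\le\aleph_1$ or $\aleph_1\le|X|$. "$\aleph_1$ is regular": $\aleph_1$ is not the union of countably many countable sets of ordinals (equivalently, its cofinality is $\aleph_1$). -}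

module Defs where

open import Level using (Level; suc)
open import Data.Nat.Base as ℕ using (ℕ)
open import Data.Fin.Base using (Fin)
open import Data.Vec.Base using (Vec; _∷_; lookup)
open import Data.Product using (∃-syntax; ∃!; _×_)
open import Data.Sum.Base using (_⊎_)
open import Data.Empty.Polymorphic using (⊥)
open import Function.Bundles using (_⇔_)
open import Relation.Nullary.Negation.Core using (¬_)
open import Relation.Binary.PropositionalEquality using (_≡_; _≢_)

-- "Working in ZF" means working inside an arbitrary structure for the
-- first-order language {∈} with equality that satisfies the ZF axioms.
-- The schemas of separation and replacement range over syntactic formulas only,
-- never over arbitrary Agda predicates on the carrier.  This matters: with
-- excluded middle for all Agda types, a schema over Agda predicates would make
-- the axiom of choice true in the structure.

infix  5 _∈′_ _≡′_
infixr 4 _∧′_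
infixr 3 _∨′_
infixr 2 _⇒′_

data Formula : ℕ → Set where
  _∈′_ _≡′_      : ∀ {n} → Fin n → Fin n → Formula n
  ⊥′             : ∀ {n} → Formula n
  _∧′_ _∨′_ _⇒′_ : ∀ {n} → Formula n → Formula n → Formula n
  ∀′ ∃′          : ∀ {n} → Formula (ℕ.suc n) → Formula n

record Structure (ℓ : Level) : Set (suc ℓ) where
  infix 4 _∈_
  field
    Carrier : Set ℓ
    _∈_     : Carrier → Carrier → Set ℓ

module _ {ℓ : Level} (𝕍 : Structure ℓ) where
  open Structure 𝕍

  Sat : ∀ {n} → Formula n → Vec Carrier n → Set ℓ
  Sat (i ∈′ j) ρ = lookup ρ i ∈ lookup ρ j
  Sat (i ≡′ j) ρ = lookup ρ i ≡ lookup ρ j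
  Sat ⊥′       ρ = ⊥
  Sat (φ ∧′ ψ) ρ = Sat φ ρ × Sat ψ ρ
  Sat (φ ∨′ ψ) ρ = Sat φ ρ ⊎ Sat ψ ρ
  Sat (φ ⇒′ ψ) ρ = Sat φ ρ → Sat ψ ρ
  Sat (∀′ φ)   ρ = ∀ x → Sat φ (x ∷ ρ)
  Sat (∃′ φ)   ρ = ∃[ x ] Sat φ (x ∷ ρ)

  -- The language has no function symbols, so ∅, {x , y}, ⟨x , y⟩, ω, … are
  -- expressed by the predicates they satisfy.  Every quantifier below ranges
  -- over Carrier.

  infix 4 _⊆_
  _⊆_ : Carrier → Carrier → Set ℓ
  x ⊆ y = ∀ z → z ∈ x → z ∈ y

  IsEmpty : Carrier → Set ℓ
  IsEmpty e = ∀ z → ¬ z ∈ e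

  IsNonempty : Carrier → Set ℓ
  IsNonempty x = ∃[ z ] z ∈ x

  IsPair : Carrier → Carrier → Carrier → Set ℓ
  IsPair p x y = ∀ z → z ∈ p ⇔ (z ≡ x ⊎ z ≡ y)

  IsUnion : Carrier → Carrier → Set ℓ
  IsUnion u F = ∀ z → z ∈ u ⇔ (∃[ A ] A ∈ F × z ∈ A)

  IsPower : Carrier → Carrier → Set ℓ
  IsPower P x = ∀ z → z ∈ P ⇔ z ⊆ x

  -- s = x ∪ {x}
  IsSucc : Carrier → Carrier → Set ℓ
  IsSucc s x = ∀ z → z ∈ s ⇔ (z ∈ x ⊎ z ≡ x)

  IsInductive : Carrier → Set ℓ
  IsInductive I = (∃[ e ] e ∈ I × IsEmpty e)
                × (∀ x → x ∈ I → ∃[ s ] s ∈ I × IsSucc s x)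

  -- In the two schemas ρ lists the parameters.  In replacement, variable 0 of φ
  -- is the argument, variable 1 the value, and φ need only be functional on a.
  record IsZF : Set ℓ where
    field
      extensionality : ∀ x y → (∀ z → z ∈ x ⇔ z ∈ y) → x ≡ y
      foundation     : ∀ x → IsNonempty x →
                       ∃[ m ] m ∈ x × (∀ z → z ∈ x → ¬ z ∈ m)
      pairing        : ∀ x y → ∃[ p ] IsPair p x y
      union          : ∀ F → ∃[ u ] IsUnion u F
      powerset       : ∀ x → ∃[ P ] IsPower P x
      infinity       : ∃[ I ] IsInductive I
      separation     : ∀ {n} (φ : Formula (1 ℕ.+ n)) (ρ : Vec Carrier n) a →
                       ∃[ b ] (∀ x → x ∈ b ⇔ (x ∈ a × Sat φ (x ∷ ρ)))
      replacement    : ∀ {n} (φ : Formula (2 ℕ.+ n)) (ρ : Vec Carrier n) a →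
                       (∀ x → x ∈ a → ∀ y y′ →
                         Sat φ (x ∷ y ∷ ρ) → Sat φ (x ∷ y′ ∷ ρ) → y ≡ y′) →
                       ∃[ b ] (∀ y → y ∈ b ⇔ (∃[ x ] x ∈ a × Sat φ (x ∷ y ∷ ρ)))

  -- p = ⟨x , y⟩ = {{x} , {x , y}}
  IsOrderedPair : Carrier → Carrier → Carrier → Set ℓ
  IsOrderedPair p x y = ∃[ a ] ∃[ b ] IsPair a x x × IsPair b x y × IsPair p a b

  -- ⟨x , y⟩ ∈ r; for a function f, Related f x y says f(x) = y.
  Related : Carrier → Carrier → Carrier → Set ℓ
  Related r x y = ∃[ p ] IsOrderedPair p x y × p ∈ r

  IsFunction : Carrier → Carrier → Carrier → Set ℓ
  IsFunction f X Y =
    (∀ p → p ∈ f → ∃[ x ] ∃[ y ] x ∈ X × y ∈ Y × IsOrderedPair p x y)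
    × (∀ x → x ∈ X → ∃! _≡_ λ y → Related f x y)

  IsInjection : Carrier → Carrier → Carrier → Set ℓ
  IsInjection f X Y = IsFunction f X Y
    × (∀ x x′ y → Related f x y → Related f x′ y → x ≡ x′)

  IsBijection : Carrier → Carrier → Carrier → Set ℓ
  IsBijection f X Y = IsInjection f X Y
    × (∀ y → y ∈ Y → ∃[ x ] Related f x y)

  -- |X| ≤ |Y|
  infix 4 _≼_
  _≼_ : Carrier → Carrier → Set ℓ
  X ≼ Y = ∃[ f ] IsInjection f X Y

  -- ω as the least inductive set.
  IsOmega : Carrier → Set ℓ
  IsOmega w = IsInductive w × (∀ I → IsInductive I → w ⊆ I)

  Countable : Carrier → Set ℓ
  Countable X = ∃[ w ] IsOmega w × X ≼ w

  Uncountable : Carrier → Set ℓ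
  Uncountable X = ¬ Countable X

  CountablyInfinite : Carrier → Set ℓ
  CountablyInfinite X = ∃[ w ] IsOmega w × (∃[ f ] IsBijection f X w)

  -- A transitive set well-ordered by ∈.  Irreflexivity and transitivity of ∈ on
  -- α follow from the last two clauses, a least-element condition ruling out
  -- ∈-cycles.
  IsOrdinal : Carrier → Set ℓ
  IsOrdinal α =
    (∀ x → x ∈ α → x ⊆ α)
    × (∀ x y → x ∈ α → y ∈ α → x ∈ y ⊎ x ≡ y ⊎ y ∈ x)
    × (∀ s → s ⊆ α → IsNonempty s → ∃[ m ] m ∈ s × (∀ z → z ∈ s → ¬ z ∈ m))

  -- ℵ₁ as the least uncountable ordinal.  The principles below quantify
  -- universally over all κ with this property; ZF proves there is exactly one.
  IsAleph₁ : Carrier → Set ℓ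
  IsAleph₁ κ = IsOrdinal κ × Uncountable κ × (∀ α → α ∈ κ → Countable α)

  -- g = f ↾ β
  IsRestriction : Carrier → Carrier → Carrier → Set ℓ
  IsRestriction g f β =
    ∀ p → p ∈ g ⇔ (p ∈ f × (∃[ x ] ∃[ y ] x ∈ β × IsOrderedPair p x y))

  DC-ℵ₁ : Set ℓ
  DC-ℵ₁ = ∀ κ → IsAleph₁ κ → ∀ S R → IsNonempty S →
    (∀ β → β ∈ κ → ∀ s → IsFunction s β S → ∃[ y ] y ∈ S × Related R s y) →
    ∃[ f ] IsFunction f κ S
      × (∀ β → β ∈ κ →
          ∃[ s ] ∃[ y ] IsRestriction s f β × Related f β y × Related R s y)

  W-ℵ₁ : Set ℓ
  W-ℵ₁ = ∀ κ → IsAleph₁ κ → ∀ X → X ≼ κ ⊎ κ ≼ X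

  ℵ₁-regular : Set ℓ
  ℵ₁-regular = ∀ κ → IsAleph₁ κ →
    ¬ (∃[ F ] Countable F
         × (∀ A → A ∈ F → Countable A × (∀ α → α ∈ A → IsOrdinal α))
         × IsUnion κ F)

  -- D = [X]²
  IsPairSet : Carrier → Carrier → Set ℓ
  IsPairSet D X =
    ∀ p → p ∈ D ⇔ (∃[ x ] ∃[ y ] x ∈ X × y ∈ X × x ≢ y × IsPair p x y)

  IsGraph : Carrier → Carrier → Set ℓ
  IsGraph V E = ∃[ D ] IsPairSet D V × E ⊆ D

  -- The colours 0 and 1 are the von Neumann numerals ∅ and {∅}.
  IsZero IsOne : Carrier → Set ℓ
  IsZero = IsEmpty
  IsOne i = ∀ z → z ∈ i ⇔ IsZero z

  -- f : [X]² → {0 , 1}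
  IsColoring : Carrier → Carrier → Set ℓ
  IsColoring f X = ∃[ D ] ∃[ T ] IsPairSet D X
    × (∀ i → i ∈ T ⇔ (IsZero i ⊎ IsOne i))
    × IsFunction f D T

  IsMonochromatic : Carrier → Carrier → Carrier → Set ℓ
  IsMonochromatic f S i = ∀ x y → x ∈ S → y ∈ S → x ≢ y →
    ∃[ p ] IsPair p x y × Related f p i

  EDM : Set ℓ
  EDM = ∀ V E → IsGraph V E → Uncountable V → ∀ f → IsColoring f V →
    (∃[ S ] ∃[ i ] S ⊆ V × Uncountable S × IsZero i × IsMonochromatic f S i)
    ⊎ (∃[ S ] ∃[ i ] S ⊆ V × CountablyInfinite S × IsOne i × IsMonochromatic f S i)

{-# OPTIONS --safe #-}

-- Either hypothesis makes ℵ₁ regular and yields an injection of an unbounded U ⊆ ℵ₁ into V: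
-- with DC, fresh elements of V are chosen ℵ₁ times, and enumerations of all countable
-- ordinals are chosen simultaneously, so that no countable set is cofinal in ℵ₁.  Now work
-- with the graph of colour 1 on U.  If every unbounded X ⊆ U has a vertex with unboundedly
-- many neighbours in X, iterating X ↦ X ∩ N(least such vertex) produces an infinite clique.
-- Otherwise all neighbourhoods in some unbounded X are bounded.  If the greedy maximal
-- independent subset of X were bounded, it would be countable, and by regularity the
-- neighbourhoods of its elements would have a common bound, contradicting maximality.
-- Least ordinals replace all further choices.
module Submission where

open import Axiom.ExcludedMiddle using (ExcludedMiddle)
open import Data.Product.Base using (_×_)
open import Defs
open import Level using (Level)
open import Data.Nat.Base as ℕ using (ℕ; zero)
open import Data.Fin.Base using (Fin; zero; suc; _↑ˡ_; _↑ʳ_)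
open import Data.Vec.Base using (Vec; _∷_; lookup; tabulate)
open import Data.Vec.Properties using (lookup∘tabulate)
open import Data.Vec.Functional as Vector using (Vector)
open import Data.Vec.Functional.Properties using (lookup-++ˡ; lookup-++ʳ)
open import Data.Product.Base using (∃; ∃-syntax; _,_; proj₁; proj₂; map₂)
open import Data.Sum.Base using (_⊎_; inj₁; inj₂; [_,_]; [_,_]′)
open import Data.Empty using (⊥-elim)
import Data.Empty.Polymorphic as Polymorphic
open import Function.Base using (_∘_; id; _$_; it)
open import Function.Bundles using (_⇔_; mk⇔; Equivalence)
open import Function.Construct.Composition using (_⇔-∘_)
open import Relation.Nullary using (¬_; yes; no)
open import Relation.Binary.PropositionalEquality
  using (_≡_; _≢_; refl; sym; trans; cong; subst; subst₂; ≢-sym)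

open Equivalence using (to; from)

-- Separation and replacement accept only formulas. Excluded middle in the metatheory can therefore
-- prove statements about the structure but never builds a set in it: whatever is cut out by a
-- property needs a definability witness, and a function exists only if a formula singles out its
-- values. This shapes the argument. `V` carries no well-order, so the combinatorics is pulled back
-- along an injection to a set of ordinals, where "the least such ordinal" is definable. Recursion
-- is developed on ω only; the one object that calls for a recursion of length ℵ₁, the greedy
-- independent set, is instead defined outright from its approximations. Regularity enters twice: it
-- gives countably many bounded neighbourhoods a common bound, and it makes every unbounded subset
-- of ℵ₁ uncountable, which turns the independent set into the required uncountable one. Under
-- `W-ℵ₁` the set `U` depends on the comparison of `V` with ℵ₁: it is ℵ₁ itself if ℵ₁ embeds in `V`,
-- and the image of `V` if `V` embeds in ℵ₁.

-- Definable predicates and definable terms.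

module Definability {ℓ : Level} (𝕍 : Structure ℓ) where
  open Structure 𝕍

  Env : Set ℓ
  Env = ℕ → Carrier

  infixr 5 _◂_
  _◂_ : ∀ {a} {A : Set a} → A → (ℕ → A) → ℕ → A
  (x ◂ ρ) zero      = x
  (x ◂ ρ) (ℕ.suc i) = ρ i

  -- P is definable by a first-order formula with parameters.  The formula is given
  -- together with all its renamings, so that weakening it and merging two parameter
  -- lists need no substitution lemmas.  Instance search assembles Def P from the shape of P.
  record Def (P : Env → Set ℓ) : Set ℓ where
    no-eta-equality
    field
      arity   : ℕ
      params  : Vector Carrier arity
      formula : ∀ {n} → (ℕ → Fin n) → Vector (Fin n) arity → Formula n
      correct : ∀ {n} (v : ℕ → Fin n) (c : Vector (Fin n) arity) (σ : Vec Carrier n) ρ →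
                (∀ i → lookup σ (v i) ≡ ρ i) → (∀ j → lookup σ (c j) ≡ params j) →
                Sat 𝕍 (formula v c) σ ⇔ P ρ
  open Def

  def-resp : ∀ {P Q} → (∀ ρ → P ρ ⇔ Q ρ) → Def P → Def Q
  def-resp P⇔Q d .arity   = d .arity
  def-resp P⇔Q d .params  = d .params
  def-resp P⇔Q d .formula = d .formula
  def-resp P⇔Q d .correct v c σ ρ hv hc = P⇔Q ρ ⇔-∘ d .correct v c σ ρ hv hc

  def-rename : ∀ {P} (r : ℕ → ℕ) → Def P → Def (λ ρ → P (ρ ∘ r))
  def-rename r d .arity   = d .arity
  def-rename r d .params  = d .params
  def-rename r d .formula v c = d .formula (v ∘ r) c
  def-rename r d .correct v c σ ρ hv hc = d .correct (v ∘ r) c σ (ρ ∘ r) (hv ∘ r) hc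

  module _ {_⊕_ : Set ℓ → Set ℓ → Set ℓ} {_⊕′_ : ∀ {n} → Formula n → Formula n → Formula n}
           (sat : ∀ {n} (φ ψ : Formula n) σ {P Q} → Sat 𝕍 φ σ ⇔ P → Sat 𝕍 ψ σ ⇔ Q →
                  Sat 𝕍 (φ ⊕′ ψ) σ ⇔ (P ⊕ Q)) where

    def-binary : ∀ {P Q} → Def P → Def Q → Def (λ ρ → P ρ ⊕ Q ρ)
    def-binary d e .arity  = d .arity ℕ.+ e .arity
    def-binary d e .params = d .params Vector.++ e .params
    def-binary d e .formula v c =
      d .formula v (λ j → c (j ↑ˡ e .arity)) ⊕′ e .formula v (λ j → c (d .arity ↑ʳ j))
    def-binary d e .correct v c σ ρ hv hc = sat _ _ σ
      (d .correct v _ σ ρ hv λ j → trans (hc (j ↑ˡ e .arity)) (lookup-++ˡ (d .params) (e .params) j))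
      (e .correct v _ σ ρ hv λ j → trans (hc (d .arity ↑ʳ j)) (lookup-++ʳ (d .params) (e .params) j))

  module _ {⨁ : (Carrier → Set ℓ) → Set ℓ} {⨁′ : ∀ {n} → Formula (ℕ.suc n) → Formula n}
           (sat : ∀ {n} (φ : Formula (ℕ.suc n)) σ {P} → (∀ x → Sat 𝕍 φ (x ∷ σ) ⇔ P x) →
                  Sat 𝕍 (⨁′ φ) σ ⇔ ⨁ P) where

    def-quantifier : ∀ {P : Env → Carrier → Set ℓ} →
                     Def (λ ρ → P (λ i → ρ (ℕ.suc i)) (ρ 0)) → Def (λ ρ → ⨁ (P ρ))
    def-quantifier d .arity  = d .arity
    def-quantifier d .params = d .params
    def-quantifier d .formula v c = ⨁′ (d .formula (zero ◂ suc ∘ v) (suc ∘ c))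
    def-quantifier d .correct v c σ ρ hv hc = sat _ σ λ x →
      d .correct _ _ (x ∷ σ) (x ◂ ρ) (λ { zero → refl ; (ℕ.suc i) → hv i }) hc

  def-∈₀ : Def (λ ρ → ρ 0 ∈ ρ 1)
  def-∈₀ .arity  = 0
  def-∈₀ .params = λ ()
  def-∈₀ .formula v c = v 0 ∈′ v 1
  def-∈₀ .correct v c σ ρ hv hc = mk⇔ (subst₂ _∈_ (hv 0) (hv 1)) (subst₂ _∈_ (sym (hv 0)) (sym (hv 1)))

  def-var : ∀ k → Def (λ ρ → ρ 0 ≡ ρ k)
  def-var k .arity  = 0
  def-var k .params = λ ()
  def-var k .formula v c = v 0 ≡′ v k
  def-var k .correct v c σ ρ hv hc = mk⇔ (λ p → trans (sym (hv 0)) (trans p (hv k)))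
                                         (λ p → trans (hv 0) (trans p (sym (hv k))))

  def-const : ∀ a → Def (λ ρ → ρ 0 ≡ a)
  def-const a .arity  = 1
  def-const a .params = λ _ → a
  def-const a .formula v c = v 0 ≡′ c zero
  def-const a .correct v c σ ρ hv hc = mk⇔ (λ p → trans (sym (hv 0)) (trans p (hc zero)))
                                           (λ p → trans (hv 0) (trans p (sym (hc zero))))

  def-⊥ : Def (λ _ → Polymorphic.⊥)
  def-⊥ .arity   = 0
  def-⊥ .params  = λ ()
  def-⊥ .formula v c = ⊥′
  def-⊥ .correct v c σ ρ hv hc = mk⇔ id id

  -- The language has no function symbols, so a term counts as definable when its graph is. The
  -- separate record keeps goals about terms apart: a bare `Def` goal for the graph would match
  -- `def-≡`, whose premises are again about terms.
  record DefT (t : Env → Carrier) : Set ℓ where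
    no-eta-equality
    constructor mkDefT
    field
      graph : Def (λ ρ → ρ 0 ≡ t (λ i → ρ (ℕ.suc i)))
  open DefT

  opaque
    instance
      def-× : ∀ {P Q : Env → Set ℓ} → ⦃ Def P ⦄ → ⦃ Def Q ⦄ → Def (λ ρ → P ρ × Q ρ)
      def-× ⦃ d ⦄ ⦃ e ⦄ = def-binary {_⊕′_ = _∧′_}
        (λ _ _ _ p q → mk⇔ (λ (x , y) → to p x , to q y) (λ (x , y) → from p x , from q y)) d e

      def-⊎ : ∀ {P Q : Env → Set ℓ} → ⦃ Def P ⦄ → ⦃ Def Q ⦄ → Def (λ ρ → P ρ ⊎ Q ρ)
      def-⊎ ⦃ d ⦄ ⦃ e ⦄ = def-binary {_⊕′_ = _∨′_}
        (λ _ _ _ p q → mk⇔ [ inj₁ ∘ to p , inj₂ ∘ to q ] [ inj₁ ∘ from p , inj₂ ∘ from q ]) d e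

      def-→ : ∀ {P Q : Env → Set ℓ} → ⦃ Def P ⦄ → ⦃ Def Q ⦄ → Def (λ ρ → P ρ → Q ρ)
      def-→ ⦃ d ⦄ ⦃ e ⦄ = def-binary {_⊕_ = λ P Q → P → Q} {_⊕′_ = _⇒′_}
        (λ _ _ _ p q → mk⇔ (λ f → to q ∘ f ∘ from p) (λ f → from q ∘ f ∘ to p)) d e

      def-∃ : ∀ {P : Env → Carrier → Set ℓ} → ⦃ Def (λ ρ → P (λ i → ρ (ℕ.suc i)) (ρ 0)) ⦄ →
              Def (λ ρ → ∃ (P ρ))
      def-∃ ⦃ d ⦄ = def-quantifier {⨁ = ∃} {⨁′ = ∃′}
        (λ _ _ p → mk⇔ (λ (x , q) → x , to (p x) q) (λ (x , q) → x , from (p x) q)) d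

      def-∀ : ∀ {P : Env → Carrier → Set ℓ} → ⦃ Def (λ ρ → P (λ i → ρ (ℕ.suc i)) (ρ 0)) ⦄ →
              Def (λ ρ → ∀ x → P ρ x)
      def-∀ ⦃ d ⦄ = def-quantifier {⨁ = λ P → ∀ x → P x} {⨁′ = ∀′}
        (λ _ _ p → mk⇔ (λ f x → to (p x) (f x)) (λ f x → from (p x) (f x))) d

      def-¬ : ∀ {P : Env → Set ℓ} → ⦃ Def P ⦄ → Def (λ ρ → ¬ P ρ)
      def-¬ ⦃ d ⦄ = def-resp (λ _ → mk⇔ (λ f → Polymorphic.⊥-elim ∘ f) (λ f → ⊥-elim ∘ f))
        (def-→ ⦃ d ⦄ ⦃ def-⊥ ⦄)

      def-⇔ : ∀ {P Q : Env → Set ℓ} → ⦃ Def P ⦄ → ⦃ Def Q ⦄ → Def (λ ρ → P ρ ⇔ Q ρ)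
      def-⇔ ⦃ d ⦄ ⦃ e ⦄ = def-resp (λ _ → mk⇔ (λ (f , g) → mk⇔ f g) (λ h → to h , from h))
        (def-× ⦃ def-→ ⦃ d ⦄ ⦃ e ⦄ ⦄ ⦃ def-→ ⦃ e ⦄ ⦃ d ⦄ ⦄)

      defT-var : ∀ {k} → DefT (λ ρ → ρ k)
      defT-var {k} .graph = def-var (ℕ.suc k)

      defT-const : ∀ {a} → DefT (λ _ → a)
      defT-const {a} .graph = def-const a

    -- Without function symbols, a term is substituted by quantifying over its value: `Q ρ (t ρ)` is
    -- read as "some `y` equals `t ρ` and satisfies `Q ρ y`".
    def-subst : ∀ (Q : Env → Carrier → Set ℓ) {t} → DefT t →
                Def (λ ρ → Q (λ i → ρ (ℕ.suc i)) (ρ 0)) → Def (λ ρ → Q ρ (t ρ))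
    def-subst Q {t} dt d =
      def-resp {P = λ ρ → ∃ λ y → y ≡ t ρ × Q ρ y}
        (λ ρ → mk⇔ (λ { (_ , refl , p) → p }) (λ p → _ , refl , p))
        (def-∃ ⦃ def-× ⦃ dt .graph ⦄ ⦃ d ⦄ ⦄)

    defT-weaken : ∀ k {t} → DefT t → DefT (λ ρ → t (λ i → ρ (k ℕ.+ i)))
    defT-weaken k dt .graph = def-rename (0 ◂ λ i → ℕ.suc (k ℕ.+ i)) (dt .graph)

    def-atom₁ : ∀ (P : Carrier → Set ℓ) {t} → Def (λ ρ → P (ρ 0)) → DefT t → Def (λ ρ → P (t ρ))
    def-atom₁ P d dt = def-subst (λ _ → P) dt (def-rename (λ _ → 0) d)

    def-atom₂ : ∀ (P : Carrier → Carrier → Set ℓ) {t u} → Def (λ ρ → P (ρ 0) (ρ 1)) →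
                DefT t → DefT u → Def (λ ρ → P (t ρ) (u ρ))
    def-atom₂ P {t} {u} d dt du =
      def-subst (λ ρ y → P y (u ρ)) dt $
      def-subst (λ ρ z → P (ρ 0) z) (defT-weaken 1 du) (def-rename (1 ◂ λ _ → 0) d)

    def-atom₃ : ∀ (P : Carrier → Carrier → Carrier → Set ℓ) {t u w} →
                Def (λ ρ → P (ρ 0) (ρ 1) (ρ 2)) →
                DefT t → DefT u → DefT w → Def (λ ρ → P (t ρ) (u ρ) (w ρ))
    def-atom₃ P {t} {u} {w} d dt du dw =
      def-subst (λ ρ x → P x (u ρ) (w ρ)) dt $
      def-subst (λ ρ y → P (ρ 0) y (w (λ i → ρ (ℕ.suc i)))) (defT-weaken 1 du) $
      def-subst (λ ρ z → P (ρ 1) (ρ 0) z) (defT-weaken 2 dw) (def-rename (2 ◂ 1 ◂ λ _ → 0) d)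

    instance
      def-∈ : ∀ {t u : Env → Carrier} → ⦃ DefT t ⦄ → ⦃ DefT u ⦄ → Def (λ ρ → t ρ ∈ u ρ)
      def-∈ ⦃ dt ⦄ ⦃ du ⦄ = def-atom₂ _∈_ def-∈₀ dt du

      def-≡ : ∀ {t u : Env → Carrier} → ⦃ DefT t ⦄ → ⦃ DefT u ⦄ → Def (λ ρ → t ρ ≡ u ρ)
      def-≡ ⦃ dt ⦄ ⦃ du ⦄ = def-atom₂ _≡_ (def-var 1) dt du

    defT-op₁ : ∀ (op : Carrier → Carrier) {t} → Def (λ ρ → ρ 0 ≡ op (ρ 1)) → DefT t →
               DefT (λ ρ → op (t ρ))
    defT-op₁ op d dt .graph = def-atom₂ (λ x y → x ≡ op y) d defT-var (defT-weaken 1 dt)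

    defT-op₂ : ∀ (op : Carrier → Carrier → Carrier) {t u} → Def (λ ρ → ρ 0 ≡ op (ρ 1) (ρ 2)) →
               DefT t → DefT u → DefT (λ ρ → op (t ρ) (u ρ))
    defT-op₂ op d dt du .graph =
      def-atom₃ (λ x y z → x ≡ op y z) d defT-var (defT-weaken 1 dt) (defT-weaken 1 du)

-- Set-theoretic operations, functions and injections inside the structure.

module SetTheory {ℓ : Level} (em : ExcludedMiddle ℓ) (𝕍 : Structure ℓ) (zf : IsZF 𝕍) where
  open Structure 𝕍
  open IsZF zf
  open Definability 𝕍

  infix  4 _⊆′_ _∉_ _≾_
  infix  6 _⁺
  infixl 6 _∪_
  infixl 7 _·_

  byContradiction : ∀ {P : Set ℓ} → ¬ ¬ P → P
  byContradiction {P} ¬¬p with em {P}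
  ... | yes p = p
  ... | no ¬p = ⊥-elim (¬¬p ¬p)

  ¬∀⇒∃¬ : ∀ {a} {P : Carrier → Set ℓ} → ¬ (∀ x → x ∈ a → P x) → ∃[ x ] x ∈ a × ¬ P x
  ¬∀⇒∃¬ ¬∀ = byContradiction λ ¬∃ → ¬∀ λ x x∈a → byContradiction λ ¬p → ¬∃ (x , x∈a , ¬p)

  _∉_ : Carrier → Carrier → Set ℓ
  x ∉ y = ¬ x ∈ y

  _⊆′_ : Carrier → Carrier → Set ℓ
  x ⊆′ y = ∀ {z} → z ∈ x → z ∈ y

  ⊆-antisym : ∀ {x y} → x ⊆′ y → y ⊆′ x → x ≡ y
  ⊆-antisym p q = extensionality _ _ λ _ → mk⇔ p q

  module _ (P : Carrier → Set ℓ) ⦃ d : Def (λ ρ → P (ρ 0)) ⦄ (a : Carrier) where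
    open Def d using (params; formula; correct)
    private
      subset : ∃[ b ] (∀ x → x ∈ b ⇔ (x ∈ a × P x))
      subset = map₂
        (λ h x → mk⇔ (map₂ (to (spec x)) ∘ to (h x)) (from (h x) ∘ map₂ (from (spec x))))
        (separation (formula (λ _ → zero) suc) (tabulate params) a)
        where
        spec : ∀ x → Sat 𝕍 (formula (λ _ → zero) suc) (x ∷ tabulate params) ⇔ P x
        spec x = correct _ _ _ (λ _ → x) (λ _ → refl) (lookup∘tabulate params)

    opaque
      sep : Carrier
      sep = proj₁ subset

      ∈-sep : ∀ {x} → x ∈ sep ⇔ (x ∈ a × P x)
      ∈-sep = proj₂ subset _

  module _ {P : Carrier → Set ℓ} ⦃ d : Def (λ ρ → P (ρ 0)) ⦄ {a x : Carrier} where
    sep⁺ : x ∈ a → P x → x ∈ sep P a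
    sep⁺ p q = from (∈-sep P a) (p , q)

    sep⊆ : x ∈ sep P a → x ∈ a
    sep⊆ p = proj₁ (to (∈-sep P a) p)

    sep⁻ : x ∈ sep P a → P x
    sep⁻ p = proj₂ (to (∈-sep P a) p)

  replace : (P : Carrier → Carrier → Set ℓ) ⦃ d : Def (λ ρ → P (ρ 0) (ρ 1)) ⦄ (a : Carrier) →
            (∀ {x y y′} → x ∈ a → P x y → P x y′ → y ≡ y′) →
            ∃[ b ] (∀ {y} → y ∈ b ⇔ (∃[ x ] x ∈ a × P x y))
  replace P ⦃ d ⦄ a functional = b , λ {y} →
    mk⇔ (λ y∈b → let (x , p , q) = to (∈-b y) y∈b in x , p , to spec q)
        (λ (x , p , q) → from (∈-b y) (x , p , from spec q))
    where
    open Def d using (params; formula; correct)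
    v : ∀ {n} → ℕ → Fin (2 ℕ.+ n)
    v = zero ◂ λ _ → suc zero
    φ : Formula _
    φ = formula v (suc ∘ suc)
    spec : ∀ {x y} → Sat 𝕍 φ (x ∷ y ∷ tabulate params) ⇔ P x y
    spec {x} {y} = correct v _ _ (x ◂ λ _ → y) (λ { zero → refl ; (ℕ.suc _) → refl })
                                               (lookup∘tabulate params)
    image : ∃[ b ] (∀ y → y ∈ b ⇔ (∃[ x ] x ∈ a × Sat 𝕍 φ (x ∷ y ∷ tabulate params)))
    image = replacement φ (tabulate params) a λ x x∈a y y′ p q → functional x∈a (to spec p) (to spec q)
    b   = proj₁ image
    ∈-b = proj₂ image

  opaque
    ｛_,_｝ : Carrier → Carrier → Carrier
    ｛ x , y ｝ = proj₁ (pairing x y)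

    ∈-pair : ∀ {x y z} → z ∈ ｛ x , y ｝ ⇔ (z ≡ x ⊎ z ≡ y)
    ∈-pair = proj₂ (pairing _ _) _

    ⋃ : Carrier → Carrier
    ⋃ F = proj₁ (union F)

    ∈-⋃ : ∀ {F z} → z ∈ ⋃ F ⇔ (∃[ A ] A ∈ F × z ∈ A)
    ∈-⋃ = proj₂ (union _) _

    𝒫 : Carrier → Carrier
    𝒫 x = proj₁ (powerset x)

    ∈-𝒫 : ∀ {x z} → z ∈ 𝒫 x ⇔ z ⊆′ x
    ∈-𝒫 = mk⇔ (λ p {u} → to (proj₂ (powerset _) _) p u) (λ p → from (proj₂ (powerset _) _) λ _ → p)

    ∅ : Carrier
    ∅ = proj₁ (proj₁ (proj₂ infinity))

    ∉∅ : ∀ {x} → x ∉ ∅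
    ∉∅ = proj₂ (proj₂ (proj₁ (proj₂ infinity))) _

    _∪_ : Carrier → Carrier → Carrier
    x ∪ y = ⋃ ｛ x , y ｝

    ∈-∪ : ∀ {x y z} → z ∈ x ∪ y ⇔ (z ∈ x ⊎ z ∈ y)
    ∈-∪ {x} {y} {z} = mk⇔ f g where
      f : z ∈ x ∪ y → z ∈ x ⊎ z ∈ y
      f p with to ∈-⋃ p
      ... | A , q , r with to ∈-pair q
      ... | inj₁ refl = inj₁ r
      ... | inj₂ refl = inj₂ r
      g : z ∈ x ⊎ z ∈ y → z ∈ x ∪ y
      g (inj₁ p) = from ∈-⋃ (x , from ∈-pair (inj₁ refl) , p)
      g (inj₂ p) = from ∈-⋃ (y , from ∈-pair (inj₂ refl) , p)

    _⁺ : Carrier → Carrier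
    x ⁺ = x ∪ ｛ x , x ｝

    ∈-⁺ : ∀ {x z} → z ∈ x ⁺ ⇔ (z ∈ x ⊎ z ≡ x)
    ∈-⁺ = mk⇔ (λ p → [ inj₁ , (λ q → inj₂ ([ id , id ]′ (to ∈-pair q))) ] (to ∈-∪ p))
              [ from ∈-∪ ∘ inj₁ , (λ q → from ∈-∪ (inj₂ (from ∈-pair (inj₁ q)))) ]

    ⟨_,_⟩ : Carrier → Carrier → Carrier
    ⟨ x , y ⟩ = ｛ ｛ x , x ｝ , ｛ x , y ｝ ｝

    ⟨⟩-def : ∀ {x y} → ⟨ x , y ⟩ ≡ ｛ ｛ x , x ｝ , ｛ x , y ｝ ｝
    ⟨⟩-def = refl

  ∈-pairˡ : ∀ {x y} → x ∈ ｛ x , y ｝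
  ∈-pairˡ = from ∈-pair (inj₁ refl)

  ∈-pairʳ : ∀ {x y} → y ∈ ｛ x , y ｝
  ∈-pairʳ = from ∈-pair (inj₂ refl)

  self∈⁺ : ∀ {x} → x ∈ x ⁺
  self∈⁺ = from ∈-⁺ (inj₂ refl)

  ⊆⁺ : ∀ {x} → x ⊆′ x ⁺
  ⊆⁺ p = from ∈-⁺ (inj₁ p)

  pair-comm : ∀ {x y} → ｛ x , y ｝ ≡ ｛ y , x ｝
  pair-comm = ⊆-antisym flip flip where
    flip : ∀ {x y} → ｛ x , y ｝ ⊆′ ｛ y , x ｝
    flip p = from ∈-pair ([ inj₂ , inj₁ ] (to ∈-pair p))

  isPair⇔ : ∀ {p x y} → IsPair 𝕍 p x y ⇔ p ≡ ｛ x , y ｝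
  isPair⇔ = mk⇔ (λ h → ⊆-antisym (λ q → from ∈-pair (to (h _) q)) (λ q → from (h _) (to ∈-pair q)))
                (λ { refl z → ∈-pair })

  pair-injectiveʳ : ∀ {x y y′} → ｛ x , y ｝ ≡ ｛ x , y′ ｝ → y ≡ y′
  pair-injectiveʳ {x} {y} {y′} e
    with to ∈-pair (subst (y ∈_) e ∈-pairʳ) | to ∈-pair (subst (y′ ∈_) (sym e) ∈-pairʳ)
  ... | inj₂ q | _ = q
  ... | inj₁ q | inj₁ r = trans q (sym r)
  ... | inj₁ q | inj₂ r = sym r

  singleton-injective : ∀ {x y z} → ｛ x , x ｝ ≡ ｛ y , z ｝ → x ≡ y × x ≡ z
  singleton-injective {y = y} {z} e =
    sym ([ id , id ]′ (to ∈-pair (subst (y ∈_) (sym e) ∈-pairˡ))) ,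
    sym ([ id , id ]′ (to ∈-pair (subst (z ∈_) (sym e) ∈-pairʳ)))

  ⟨⟩-injective : ∀ {x y x′ y′} → ⟨ x , y ⟩ ≡ ⟨ x′ , y′ ⟩ → x ≡ x′ × y ≡ y′
  ⟨⟩-injective {x} {y} {x′} {y′} e = lemma (trans (sym ⟨⟩-def) (trans e ⟨⟩-def)) where
    lemma : ｛ ｛ x , x ｝ , ｛ x , y ｝ ｝ ≡ ｛ ｛ x′ , x′ ｝ , ｛ x′ , y′ ｝ ｝ → x ≡ x′ × y ≡ y′
    lemma e with to ∈-pair (subst (｛ x , x ｝ ∈_) e ∈-pairˡ)
    ... | inj₁ q with refl ← proj₁ (singleton-injective q) = refl , pair-injectiveʳ (pair-injectiveʳ e)
    ... | inj₂ q with refl , refl ← singleton-injective q =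
      refl , pair-injectiveʳ (pair-injectiveʳ e)

  isOrderedPair⇔ : ∀ {p x y} → IsOrderedPair 𝕍 p x y ⇔ p ≡ ⟨ x , y ⟩
  isOrderedPair⇔ {p} {x} {y} = mk⇔ f g where
    f : IsOrderedPair 𝕍 p x y → p ≡ ⟨ x , y ⟩
    f (a , b , ha , hb , hp) with refl ← to isPair⇔ ha | refl ← to isPair⇔ hb =
      trans (to isPair⇔ hp) (sym ⟨⟩-def)
    g : p ≡ ⟨ x , y ⟩ → IsOrderedPair 𝕍 p x y
    g e = _ , _ , from isPair⇔ refl , from isPair⇔ refl , from isPair⇔ (trans e ⟨⟩-def)

  related⇔ : ∀ {r x y} → Related 𝕍 r x y ⇔ ⟨ x , y ⟩ ∈ r
  related⇔ {r} = mk⇔ (λ (_ , h , q) → subst (_∈ r) (to isOrderedPair⇔ h) q)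
                     (λ q → _ , from isOrderedPair⇔ refl , q)

  ≡⇔ext : ∀ {x : Carrier} {y} {P : Carrier → Set ℓ} → (∀ {z} → z ∈ y ⇔ P z) →
          (∀ z → z ∈ x ⇔ P z) ⇔ x ≡ y
  ≡⇔ext h = mk⇔ (λ k → ⊆-antisym (λ p → from h (to (k _) p)) (λ p → from (k _) (to h p)))
                (λ { refl z → h })

  instance
    defT-pair : ∀ {t u : Env → Carrier} → ⦃ DefT t ⦄ → ⦃ DefT u ⦄ → DefT (λ ρ → ｛ t ρ , u ρ ｝)
    defT-pair ⦃ dt ⦄ ⦃ du ⦄ = defT-op₂ ｛_,_｝
      (def-resp {P = λ ρ → ∀ z → z ∈ ρ 0 ⇔ (z ≡ ρ 1 ⊎ z ≡ ρ 2)} (λ _ → ≡⇔ext ∈-pair) def-∀) dt du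

    defT-⟨⟩ : ∀ {t u : Env → Carrier} → ⦃ DefT t ⦄ → ⦃ DefT u ⦄ → DefT (λ ρ → ⟨ t ρ , u ρ ⟩)
    defT-⟨⟩ ⦃ dt ⦄ ⦃ du ⦄ = defT-op₂ ⟨_,_⟩
      (def-resp {P = λ ρ → ρ 0 ≡ ｛ ｛ ρ 1 , ρ 1 ｝ , ｛ ρ 1 , ρ 2 ｝ ｝}
        (λ _ → mk⇔ (λ e → trans e (sym ⟨⟩-def)) (λ e → trans e ⟨⟩-def)) it) dt du

    defT-⁺ : ∀ {t : Env → Carrier} → ⦃ DefT t ⦄ → DefT (λ ρ → t ρ ⁺)
    defT-⁺ ⦃ dt ⦄ = defT-op₁ _⁺
      (def-resp {P = λ ρ → ∀ z → z ∈ ρ 0 ⇔ (z ∈ ρ 1 ⊎ z ≡ ρ 1)} (λ _ → ≡⇔ext ∈-⁺) def-∀) dt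

  opaque
    _×ˢ_ : Carrier → Carrier → Carrier
    X ×ˢ Y = sep (λ p → ∃[ x ] ∃[ y ] x ∈ X × y ∈ Y × p ≡ ⟨ x , y ⟩) (𝒫 (𝒫 (X ∪ Y)))

    ∈-×ˢ : ∀ {X Y p} → p ∈ X ×ˢ Y ⇔ (∃[ x ] ∃[ y ] x ∈ X × y ∈ Y × p ≡ ⟨ x , y ⟩)
    ∈-×ˢ {X} {Y} = mk⇔ sep⁻ λ { (x , y , x∈X , y∈Y , refl) →
      let ⊆∪ : ∀ {u v} → u ∈ X ∪ Y → v ∈ X ∪ Y → ｛ u , v ｝ ∈ 𝒫 (X ∪ Y)
          ⊆∪ p q = from ∈-𝒫 λ r →
            [ (λ e → subst (_∈ _) (sym e) p) , (λ e → subst (_∈ _) (sym e) q) ]′ (to ∈-pair r)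
          x∈ = from ∈-∪ (inj₁ x∈X)
          y∈ = from ∈-∪ (inj₂ y∈Y)
      in sep⁺ (from ∈-𝒫 λ {z} r →
                [ (λ e → subst (_∈ _) (sym e) (⊆∪ x∈ x∈)) , (λ e → subst (_∈ _) (sym e) (⊆∪ x∈ y∈)) ]′
                  (to ∈-pair (subst (z ∈_) ⟨⟩-def r)))
              (x , y , x∈X , y∈Y , refl) }

  ⟨⟩∈×ˢ : ∀ {X Y x y} → ⟨ x , y ⟩ ∈ X ×ˢ Y ⇔ (x ∈ X × y ∈ Y)
  ⟨⟩∈×ˢ {X} {Y} {x} {y} = mk⇔ f (λ (p , q) → from ∈-×ˢ (x , y , p , q , refl)) where
    f : ⟨ x , y ⟩ ∈ X ×ˢ Y → x ∈ X × y ∈ Y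
    f h with _ , _ , p , q , e ← to ∈-×ˢ h with refl , refl ← ⟨⟩-injective e = p , q

  record Fun (f X Y : Carrier) : Set ℓ where
    field
      graph⊆  : ∀ {p} → p ∈ f → p ∈ X ×ˢ Y
      total   : ∀ {x} → x ∈ X → ∃[ y ] ⟨ x , y ⟩ ∈ f
      unique  : ∀ {x y y′} → ⟨ x , y ⟩ ∈ f → ⟨ x , y′ ⟩ ∈ f → y ≡ y′

    dom : ∀ {x y} → ⟨ x , y ⟩ ∈ f → x ∈ X
    dom h = proj₁ (to ⟨⟩∈×ˢ (graph⊆ h))

    cod : ∀ {x y} → ⟨ x , y ⟩ ∈ f → y ∈ Y
    cod h = proj₂ (to ⟨⟩∈×ˢ (graph⊆ h))
  open Fun

  record Inj (f X Y : Carrier) : Set ℓ where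
    field
      fun       : Fun f X Y
      injective : ∀ {x x′ y} → ⟨ x , y ⟩ ∈ f → ⟨ x′ , y ⟩ ∈ f → x ≡ x′
  open Inj

  _≾_ : Carrier → Carrier → Set ℓ
  X ≾ Y = ∃[ f ] Inj f X Y

  -- f · x is the value of f at x, and ∅ if x is outside the domain of f.
  opaque
    _·_ : Carrier → Carrier → Carrier
    f · x = ⋃ (sep (λ y → ⟨ x , y ⟩ ∈ f) (⋃ (⋃ f)))

    ∈-· : ∀ {f x z} → z ∈ f · x ⇔ (∃[ y ] ⟨ x , y ⟩ ∈ f × z ∈ y)
    ∈-· {f} {x} = mk⇔ (λ p → let (y , q , r) = to ∈-⋃ p in y , sep⁻ q , r) λ (y , q , r) →
      from ∈-⋃ (y , sep⁺ (from ∈-⋃ (｛ x , y ｝ , from ∈-⋃ (⟨ x , y ⟩ , q ,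
                            subst (｛ x , y ｝ ∈_) (sym ⟨⟩-def) ∈-pairʳ) , ∈-pairʳ)) q , r)

  module _ {f X Y : Carrier} (F : Fun f X Y) where
    ·-value : ∀ {x y} → ⟨ x , y ⟩ ∈ f → f · x ≡ y
    ·-value {x} {y} h = ⊆-antisym
      (λ {z} p → let (y′ , q , r) = to ∈-· p in subst (z ∈_) (F .unique q h) r)
      (λ p → from ∈-· (y , h , p))

    ·-graph : ∀ {x} → x ∈ X → ⟨ x , f · x ⟩ ∈ f
    ·-graph {x} x∈X with y , h ← F .total x∈X = subst (λ v → ⟨ x , v ⟩ ∈ f) (sym (·-value h)) h

    ·-cod : ∀ {x} → x ∈ X → f · x ∈ Y
    ·-cod x∈X = cod F (·-graph x∈X)

  ·-injective : ∀ {f X Y} → Inj f X Y → ∀ {x x′} → x ∈ X → x′ ∈ X → f · x ≡ f · x′ → x ≡ x′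
  ·-injective {f} F {x} x∈X x′∈X e = F .injective (subst (λ v → ⟨ x , v ⟩ ∈ f) e (·-graph (F .fun) x∈X))
                                              (·-graph (F .fun) x′∈X)

  fun-ext : ∀ {f g X Y} → Fun f X Y → Fun g X Y → (∀ {x} → x ∈ X → f · x ≡ g · x) → f ≡ g
  fun-ext F G h = ⊆-antisym (half F G h) (half G F (sym ∘ h)) where
    half : ∀ {f g X Y} → Fun f X Y → Fun g X Y → (∀ {x} → x ∈ X → f · x ≡ g · x) → f ⊆′ g
    half {f} {g} F G h p with x , y , x∈X , y∈Y , refl ← to ∈-×ˢ (F .graph⊆ p) =
      subst (λ v → ⟨ x , v ⟩ ∈ g) (trans (sym (h x∈X)) (·-value F p)) (·-graph G x∈X)

  -- Most maps below are cut out of a product in this way; `relFun` and `relInj` then reduce their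
  -- properties to existence and uniqueness of values. The definability premise concerns the pair,
  -- the one variable that separation ranges over.
  module _ (X Y : Carrier) (P : Carrier → Carrier → Set ℓ)
           ⦃ d : Def (λ ρ → ∃ λ x → ∃ λ y → ρ 0 ≡ ⟨ x , y ⟩ × P x y) ⦄ where
    opaque
      rel : Carrier
      rel = sep (λ p → ∃ λ x → ∃ λ y → p ≡ ⟨ x , y ⟩ × P x y) ⦃ d ⦄ (X ×ˢ Y)

      ∈-rel : ∀ {p} → p ∈ rel ⇔ (p ∈ X ×ˢ Y × ∃ λ x → ∃ λ y → p ≡ ⟨ x , y ⟩ × P x y)
      ∈-rel = ∈-sep (λ p → ∃ λ x → ∃ λ y → p ≡ ⟨ x , y ⟩ × P x y) ⦃ d ⦄ (X ×ˢ Y)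

  module _ {X Y : Carrier} {P : Carrier → Carrier → Set ℓ}
           ⦃ d : Def (λ ρ → ∃ λ x → ∃ λ y → ρ 0 ≡ ⟨ x , y ⟩ × P x y) ⦄ where
    private
      R : Carrier
      R = rel X Y P ⦃ d ⦄

      ∈R : ∀ {p} → p ∈ R ⇔ (p ∈ X ×ˢ Y × ∃ λ x → ∃ λ y → p ≡ ⟨ x , y ⟩ × P x y)
      ∈R = ∈-rel X Y P ⦃ d ⦄

    rel⁺ : ∀ {x y} → x ∈ X → y ∈ Y → P x y → ⟨ x , y ⟩ ∈ rel X Y P ⦃ d ⦄
    rel⁺ p q r = from ∈R (from ⟨⟩∈×ˢ (p , q) , _ , _ , refl , r)

    rel⊆ : ∀ {x y} → ⟨ x , y ⟩ ∈ rel X Y P ⦃ d ⦄ → x ∈ X × y ∈ Y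
    rel⊆ h = to ⟨⟩∈×ˢ (proj₁ (to ∈R h))

    rel⁻ : ∀ {x y} → ⟨ x , y ⟩ ∈ rel X Y P ⦃ d ⦄ → P x y
    rel⁻ h with _ , _ , e , p ← proj₂ (to ∈R h) with refl , refl ← ⟨⟩-injective e = p

    relFun : (∀ {x} → x ∈ X → ∃[ y ] y ∈ Y × P x y) →
             (∀ {x y y′} → x ∈ X → y ∈ Y → y′ ∈ Y → P x y → P x y′ → y ≡ y′) →
             Fun (rel X Y P ⦃ d ⦄) X Y
    relFun ex un .graph⊆ p = proj₁ (to ∈R p)
    relFun ex un .total x∈X with y , y∈Y , p ← ex x∈X = y , rel⁺ x∈X y∈Y p
    relFun ex un .unique h h′ =
      un (proj₁ (rel⊆ h)) (proj₂ (rel⊆ h)) (proj₂ (rel⊆ h′)) (rel⁻ h) (rel⁻ h′)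

    relInj : (∀ {x} → x ∈ X → ∃[ y ] y ∈ Y × P x y) →
             (∀ {x y y′} → x ∈ X → y ∈ Y → y′ ∈ Y → P x y → P x y′ → y ≡ y′) →
             (∀ {x x′ y} → x ∈ X → x′ ∈ X → y ∈ Y → P x y → P x′ y → x ≡ x′) →
             Inj (rel X Y P ⦃ d ⦄) X Y
    relInj ex un inj .fun = relFun ex un
    relInj ex un inj .injective h h′ =
      inj (proj₁ (rel⊆ h)) (proj₁ (rel⊆ h′)) (proj₂ (rel⊆ h)) (rel⁻ h) (rel⁻ h′)

  instance
    defT-· : ∀ {t u : Env → Carrier} → ⦃ DefT t ⦄ → ⦃ DefT u ⦄ → DefT (λ ρ → t ρ · u ρ)
    defT-· ⦃ dt ⦄ ⦃ du ⦄ = defT-op₂ _·_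
      (def-resp {P = λ ρ → ∀ z → z ∈ ρ 0 ⇔ (∃[ y ] ⟨ ρ 2 , y ⟩ ∈ ρ 1 × z ∈ y)}
        (λ _ → ≡⇔ext ∈-·) def-∀) dt du

    defT-×ˢ : ∀ {t u : Env → Carrier} → ⦃ DefT t ⦄ → ⦃ DefT u ⦄ → DefT (λ ρ → t ρ ×ˢ u ρ)
    defT-×ˢ ⦃ dt ⦄ ⦃ du ⦄ = defT-op₂ _×ˢ_
      (def-resp {P = λ ρ → ∀ z → z ∈ ρ 0 ⇔ (∃[ x ] ∃[ y ] x ∈ ρ 1 × y ∈ ρ 2 × z ≡ ⟨ x , y ⟩)}
        (λ _ → ≡⇔ext ∈-×ˢ) def-∀) dt du

    def-Fun : ∀ {f X Y : Env → Carrier} → ⦃ DefT f ⦄ → ⦃ DefT X ⦄ → ⦃ DefT Y ⦄ →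
              Def (λ ρ → Fun (f ρ) (X ρ) (Y ρ))
    def-Fun ⦃ df ⦄ ⦃ dX ⦄ ⦃ dY ⦄ = def-atom₃ Fun (def-resp
      {P = λ ρ → (∀ p → p ∈ ρ 0 → p ∈ ρ 1 ×ˢ ρ 2)
               × (∀ x → x ∈ ρ 1 → ∃[ y ] ⟨ x , y ⟩ ∈ ρ 0)
               × (∀ x y y′ → ⟨ x , y ⟩ ∈ ρ 0 → ⟨ x , y′ ⟩ ∈ ρ 0 → y ≡ y′)}
      (λ _ → mk⇔ (λ (g , t , u) → record { graph⊆ = g _ ; total = t _ ; unique = u _ _ _ })
                 (λ F → (λ _ → F .graph⊆) , (λ _ → F .total) , (λ _ _ _ → F .unique)))
      it) df dX dY

    def-Inj : ∀ {f X Y : Env → Carrier} → ⦃ DefT f ⦄ → ⦃ DefT X ⦄ → ⦃ DefT Y ⦄ →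
              Def (λ ρ → Inj (f ρ) (X ρ) (Y ρ))
    def-Inj ⦃ df ⦄ ⦃ dX ⦄ ⦃ dY ⦄ = def-atom₃ Inj (def-resp
      {P = λ ρ → Fun (ρ 0) (ρ 1) (ρ 2)
               × (∀ x x′ y → ⟨ x , y ⟩ ∈ ρ 0 → ⟨ x′ , y ⟩ ∈ ρ 0 → x ≡ x′)}
      (λ _ → mk⇔ (λ (f , i) → record { fun = f ; injective = i _ _ _ })
                 (λ F → F .fun , (λ _ _ _ → F .injective)))
      it) df dX dY

  ⊆⇒≾ : ∀ {X Y} → X ⊆′ Y → X ≾ Y
  ⊆⇒≾ {X} {Y} X⊆Y = rel X Y _≡_ ,
    relInj (λ p → _ , X⊆Y p , refl) (λ { _ _ _ refl refl → refl }) (λ { _ _ _ refl refl → refl })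

  ≾-trans : ∀ {X Y Z} → X ≾ Y → Y ≾ Z → X ≾ Z
  ≾-trans {X} {Y} {Z} (f , F) (g , G) = rel X Z (λ x z → z ≡ g · (f · x)) ,
    relInj (λ p → _ , ·-cod (G .fun) (·-cod (F .fun) p) , refl)
           (λ { _ _ _ refl refl → refl })
           (λ { p q _ refl e → ·-injective F p q
                                 (·-injective G (·-cod (F .fun) p) (·-cod (F .fun) q) e) })

  range : Carrier → Carrier → Carrier → Carrier
  range f X Y = sep (λ y → ∃[ x ] x ∈ X × y ≡ f · x) Y

  converse : ∀ {f X Y} → Inj f X Y → ∃[ g ] Inj g (range f X Y) X
                                     × (∀ {x} → x ∈ X → ⟨ f · x , x ⟩ ∈ g)
                                     × (∀ {x y} → ⟨ y , x ⟩ ∈ g → y ≡ f · x)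
  converse {f} {X} {Y} F = rel (range f X Y) X (λ y x → y ≡ f · x) ,
    relInj (λ p → sep⁻ p) (λ { _ q r refl e → ·-injective F q r e }) (λ { _ _ _ refl refl → refl }) ,
    (λ p → rel⁺ (sep⁺ (·-cod (F .fun) p) (_ , p , refl)) p refl) , rel⁻

  isFunction⇔ : ∀ {f X Y} → IsFunction 𝕍 f X Y ⇔ Fun f X Y
  isFunction⇔ {f} {X} {Y} = mk⇔ g h where
    g : IsFunction 𝕍 f X Y → Fun f X Y
    g (sub , un) .graph⊆ p with x , y , x∈X , y∈Y , op ← sub _ p =
      from ∈-×ˢ (x , y , x∈X , y∈Y , to isOrderedPair⇔ op)
    g (sub , un) .total x∈X with y , r , _ ← un _ x∈X = y , to related⇔ r
    g (sub , un) .unique p q with x , y , x∈X , y∈Y , op ← sub _ p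
      with refl , refl ← ⟨⟩-injective (to isOrderedPair⇔ op) with _ , _ , u ← un _ x∈X =
      trans (sym (u (from related⇔ p))) (u (from related⇔ q))
    h : Fun f X Y → IsFunction 𝕍 f X Y
    h F = (λ p p∈f → let (x , y , x∈X , y∈Y , e) = to ∈-×ˢ (F .graph⊆ p∈f) in
                     x , y , x∈X , y∈Y , from isOrderedPair⇔ e) ,
          (λ x x∈X → let (y , p) = F .total x∈X in
                     y , from related⇔ p , λ q → F .unique p (to related⇔ q))

  isInjection⇔ : ∀ {f X Y} → IsInjection 𝕍 f X Y ⇔ Inj f X Y
  isInjection⇔ = mk⇔
    (λ (F , i) → record { fun = to isFunction⇔ F
                        ; injective = λ p q → i _ _ _ (from related⇔ p) (from related⇔ q) })
    (λ F → from isFunction⇔ (F .fun) , λ _ _ _ p q → F .injective (to related⇔ p) (to related⇔ q))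

  ≼⇔ : ∀ {X Y} → _≼_ 𝕍 X Y ⇔ X ≾ Y
  ≼⇔ = mk⇔ (map₂ (to isInjection⇔)) (map₂ (from isInjection⇔))

-- Ordinals, ω and recursion on ω.

module Ordinals {ℓ : Level} (em : ExcludedMiddle ℓ) (𝕍 : Structure ℓ) (zf : IsZF 𝕍) where
  open Structure 𝕍
  open IsZF zf using (foundation; infinity)
  open Definability 𝕍
  open SetTheory em 𝕍 zf

  ∈-irrefl : ∀ {x} → x ∉ x
  ∈-irrefl {x} p with m , m∈ , h ← foundation ｛ x , x ｝ (x , ∈-pairˡ)
    with refl ← [ id , id ]′ (to ∈-pair m∈) = h x ∈-pairˡ p

  ∈-asym : ∀ {x y} → x ∈ y → y ∉ x
  ∈-asym {x} {y} p q with m , m∈ , h ← foundation ｛ x , y ｝ (x , ∈-pairˡ) with to ∈-pair m∈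
  ... | inj₁ refl = h y ∈-pairʳ q
  ... | inj₂ refl = h x ∈-pairˡ p

  ∈-acyclic₃ : ∀ {x y z} → x ∈ y → y ∈ z → z ∉ x
  ∈-acyclic₃ {x} {y} {z} p q r
    with m , m∈ , h ← foundation (｛ x , y ｝ ∪ ｛ z , z ｝) (x , from ∈-∪ (inj₁ ∈-pairˡ))
    with to ∈-∪ m∈
  ... | inj₂ m∈z with refl ← [ id , id ]′ (to ∈-pair m∈z) = h y (from ∈-∪ (inj₁ ∈-pairʳ)) q
  ... | inj₁ m∈xy with to ∈-pair m∈xy
  ... | inj₁ refl = h z (from ∈-∪ (inj₂ ∈-pairˡ)) r
  ... | inj₂ refl = h x (from ∈-∪ (inj₁ ∈-pairˡ)) p

  minimal : ∀ (P : Carrier → Set ℓ) ⦃ d : Def (λ ρ → P (ρ 0)) ⦄ {a} → (∃[ x ] x ∈ a × P x) →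
            ∃[ m ] m ∈ a × P m × (∀ {z} → z ∈ a → z ∈ m → ¬ P z)
  minimal P {a} (x , x∈a , p) with m , m∈ , h ← foundation (sep P a) (x , sep⁺ x∈a p) =
    m , sep⊆ m∈ , sep⁻ m∈ , λ z∈a z∈m q → h _ (sep⁺ z∈a q) z∈m

  Comparable : Carrier → Carrier → Set ℓ
  Comparable x y = x ∈ y ⊎ x ≡ y ⊎ y ∈ x

  -- Foundation makes `∈` well-founded on every set, and `isOrdinal⇔` recovers the least-element
  -- clause of `IsOrdinal` from it.
  record Ord (α : Carrier) : Set ℓ where
    field
      transitive : ∀ {x y} → x ∈ y → y ∈ α → x ∈ α
      compare    : ∀ {x y} → x ∈ α → y ∈ α → Comparable x y
  open Ord

  isOrdinal⇔ : ∀ {α} → IsOrdinal 𝕍 α ⇔ Ord α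
  isOrdinal⇔ = mk⇔
    (λ (t , c , _) → record { transitive = λ p q → t _ q _ p ; compare = c _ _ })
    (λ o → (λ _ p _ q → o .transitive q p) , (λ _ _ → o .compare) , λ s _ → foundation s)

  module _ {α : Carrier} (o : Ord α) where
    ∈-ord : ∀ {x} → x ∈ α → Ord x
    ∈-ord {x} x∈α .transitive {w} {z} w∈z z∈x
      with o .compare (o .transitive w∈z (o .transitive z∈x x∈α)) x∈α
    ... | inj₁ w∈x = w∈x
    ... | inj₂ (inj₁ refl) = ⊥-elim (∈-asym w∈z z∈x)
    ... | inj₂ (inj₂ x∈w) = ⊥-elim (∈-acyclic₃ w∈z z∈x x∈w)
    ∈-ord x∈α .compare p q = o .compare (o .transitive p x∈α) (o .transitive q x∈α)

    least : ∀ (P : Carrier → Set ℓ) ⦃ d : Def (λ ρ → P (ρ 0)) ⦄ → (∃[ x ] x ∈ α × P x) →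
            ∃[ m ] m ∈ α × P m × (∀ z → z ∈ m → ¬ P z)
    least P ex with m , m∈α , p , h ← minimal P ex =
      m , m∈α , p , λ _ z∈m → h (o .transitive z∈m m∈α) z∈m

    -- With `least`, this makes "the least ordinal satisfying `P`" a total and single-valued
    -- definable relation, ready for `relFun`.
    least-unique : ∀ {P : Carrier → Set ℓ} {m m′} → m ∈ α → m′ ∈ α →
                   P m × (∀ z → z ∈ m → ¬ P z) → P m′ × (∀ z → z ∈ m′ → ¬ P z) → m ≡ m′
    least-unique m∈α m′∈α (p , h) (p′ , h′) with o .compare m∈α m′∈α
    ... | inj₁ m∈m′ = ⊥-elim (h′ _ m∈m′ p)
    ... | inj₂ (inj₁ e) = e
    ... | inj₂ (inj₂ m′∈m) = ⊥-elim (h _ m′∈m p′)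

    ord-induction : ∀ (P : Carrier → Set ℓ) ⦃ d : Def (λ ρ → P (ρ 0)) ⦄ →
                    (∀ {x} → x ∈ α → (∀ {y} → y ∈ x → P y) → P x) → ∀ {x} → x ∈ α → P x
    ord-induction P step x∈α = byContradiction λ ¬p →
      let (m , m∈α , ¬pm , h) = least (λ x → ¬ P x) (_ , x∈α , ¬p)
      in ¬pm (step m∈α λ y∈m → byContradiction (h _ y∈m))

    -- If `t` is proper, it equals the least `m ∈ α` outside it: all elements of `m` lie in `t` by
    -- leastness, and an element of `t` not below `m` would drag `m` into `t`.
    transitive-subset : ∀ {t} → t ⊆′ α → (∀ {x y} → x ∈ y → y ∈ t → x ∈ t) → t ≡ α ⊎ t ∈ α
    transitive-subset {t} t⊆α trans-t with em {∃[ x ] x ∈ α × x ∉ t}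
    ... | no ¬ex = inj₁ (⊆-antisym t⊆α λ x∈α → byContradiction λ x∉t → ¬ex (_ , x∈α , x∉t))
    ... | yes ex with m , m∈α , m∉t , h ← least (_∉ t) ex =
      inj₂ (subst (_∈ α) (⊆-antisym (λ z∈m → byContradiction (h _ z∈m)) below) m∈α)
      where
      below : t ⊆′ m
      below z∈t with o .compare (t⊆α z∈t) m∈α
      ... | inj₁ z∈m = z∈m
      ... | inj₂ (inj₁ refl) = ⊥-elim (m∉t z∈t)
      ... | inj₂ (inj₂ m∈z) = ⊥-elim (m∉t (trans-t m∈z z∈t))

  -- The intersection is a transitive subset of both ordinals. Were it a proper one in both, it
  -- would be an element of both, hence of itself.
  ord-compare : ∀ {α β} → Ord α → Ord β → Comparable α β
  ord-compare {α} {β} oα oβ = combine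
    (transitive-subset oα {α∩β} sep⊆ trans-∩) (transitive-subset oβ {α∩β} sep⁻ trans-∩)
    where
    α∩β = sep (_∈ β) α
    trans-∩ : ∀ {x y} → x ∈ y → y ∈ α∩β → x ∈ α∩β
    trans-∩ p q = sep⁺ (oα .transitive p (sep⊆ q)) (oβ .transitive p (sep⁻ q))
    combine : α∩β ≡ α ⊎ α∩β ∈ α → α∩β ≡ β ⊎ α∩β ∈ β → Comparable α β
    combine (inj₁ e) (inj₁ e′) = inj₂ (inj₁ (trans (sym e) e′))
    combine (inj₁ e) (inj₂ p)  = inj₁ (subst (_∈ β) e p)
    combine (inj₂ p) (inj₁ e)  = inj₂ (inj₂ (subst (_∈ α) e p))
    combine (inj₂ p) (inj₂ q)  = ⊥-elim (∈-irrefl (sep⁺ p q))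

  ⁺-ord : ∀ {α} → Ord α → Ord (α ⁺)
  ⁺-ord {α} o = record
    { transitive = λ p q → ⊆⁺ ([ o .transitive p , (λ { refl → p }) ] (to ∈-⁺ q))
    ; compare    = λ p q → ord-compare (ord p) (ord q)
    }
    where
    ord : ∀ {x} → x ∈ α ⁺ → Ord x
    ord p = [ ∈-ord o , (λ { refl → o }) ] (to ∈-⁺ p)

  ∅-ord : Ord ∅
  ∅-ord = record { transitive = λ _ q → ⊥-elim (∉∅ q) ; compare = λ p _ → ⊥-elim (∉∅ p) }

  instance
    def-Ord : ∀ {t : Env → Carrier} → ⦃ DefT t ⦄ → Def (λ ρ → Ord (t ρ))
    def-Ord ⦃ dt ⦄ = def-atom₁ Ord (def-resp
      {P = λ ρ → (∀ x y → x ∈ y → y ∈ ρ 0 → x ∈ ρ 0)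
               × (∀ x y → x ∈ ρ 0 → y ∈ ρ 0 → x ∈ y ⊎ x ≡ y ⊎ y ∈ x)}
      (λ _ → mk⇔ (λ (t , c) → record { transitive = t _ _ ; compare = c _ _ })
                 (λ o → (λ _ _ → o .transitive) , (λ _ _ → o .compare)))
      it) dt

  isEmpty⇔ : ∀ {e} → IsEmpty 𝕍 e ⇔ e ≡ ∅
  isEmpty⇔ = mk⇔ (λ h → ⊆-antisym (λ p → ⊥-elim (h _ p)) (λ p → ⊥-elim (∉∅ p))) (λ { refl _ → ∉∅ })

  isSucc⇔ : ∀ {s x} → IsSucc 𝕍 s x ⇔ s ≡ x ⁺
  isSucc⇔ = ≡⇔ext ∈-⁺

  Inductive : Carrier → Set ℓ
  Inductive J = ∅ ∈ J × (∀ n → n ∈ J → n ⁺ ∈ J)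

  isInductive⇔ : ∀ {J} → IsInductive 𝕍 J ⇔ Inductive J
  isInductive⇔ {J} = mk⇔
    (λ ((_ , e∈J , e) , s) → subst (_∈ J) (to isEmpty⇔ e) e∈J ,
       λ n n∈J → let (_ , s∈J , h) = s n n∈J in subst (_∈ J) (to isSucc⇔ h) s∈J)
    (λ (z , s) → (∅ , z , from isEmpty⇔ refl) , λ n n∈J → n ⁺ , s n n∈J , from isSucc⇔ refl)

  private
    inductiveSet : ∃[ I ] Inductive I
    inductiveSet = map₂ (to isInductive⇔) infinity

  opaque
    ω : Carrier
    ω = sep (λ n → ∀ J → Inductive J → n ∈ J) (proj₁ inductiveSet)

    ω-least : ∀ {J} → Inductive J → ω ⊆′ J
    ω-least ind n∈ω = sep⁻ n∈ω _ ind

    ω-inductive : Inductive ω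
    ω-inductive = sep⁺ (proj₁ (proj₂ inductiveSet)) (λ _ → proj₁) ,
      λ n n∈ω → sep⁺ (proj₂ (proj₂ inductiveSet) n (sep⊆ n∈ω))
                     (λ J ind → proj₂ ind n (sep⁻ n∈ω J ind))

  ∅∈ω : ∅ ∈ ω
  ∅∈ω = proj₁ ω-inductive

  ⁺∈ω : ∀ {n} → n ∈ ω → n ⁺ ∈ ω
  ⁺∈ω = proj₂ ω-inductive _

  isOmega⇔ : ∀ {w} → IsOmega 𝕍 w ⇔ w ≡ ω
  isOmega⇔ = mk⇔
    (λ (ind , l) → ⊆-antisym (l ω (from isInductive⇔ ω-inductive) _) (ω-least (to isInductive⇔ ind)))
    (λ { refl → from isInductive⇔ ω-inductive , λ I ind _ → ω-least (to isInductive⇔ ind) })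

  countable⇔ : ∀ {X} → Countable 𝕍 X ⇔ X ≾ ω
  countable⇔ {X} = mk⇔
    (λ (w , isω , h) → subst (X ≾_) (to isOmega⇔ isω) (to ≼⇔ h))
    (λ h → ω , from isOmega⇔ refl , from ≼⇔ h)

  ω-induction : ∀ (P : Carrier → Set ℓ) ⦃ d : Def (λ ρ → P (ρ 0)) ⦄ →
                P ∅ → (∀ {n} → n ∈ ω → P n → P (n ⁺)) → ∀ {n} → n ∈ ω → P n
  ω-induction P z s n∈ω = sep⁻ (ω-least {sep P ω}
    (sep⁺ ∅∈ω z , λ _ p → sep⁺ (⁺∈ω (sep⊆ p)) (s (sep⊆ p) (sep⁻ p))) n∈ω)

  ω-cases : ∀ {n} → n ∈ ω → n ≡ ∅ ⊎ (∃[ k ] k ∈ ω × n ≡ k ⁺)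
  ω-cases = ω-induction (λ n → n ≡ ∅ ⊎ (∃[ k ] k ∈ ω × n ≡ k ⁺)) (inj₁ refl)
                        (λ n∈ω _ → inj₂ (_ , n∈ω , refl))

  ω-ord : Ord ω
  ω-ord = record
    { transitive = λ p q → ω-induction (λ n → ∀ m → m ∈ n → m ∈ ω) (λ _ m∈∅ → ⊥-elim (∉∅ m∈∅))
        (λ n∈ω h m m∈n⁺ → [ h m , (λ { refl → n∈ω }) ] (to ∈-⁺ m∈n⁺)) q _ p
    ; compare    = λ p q → ord-compare (ord p) (ord q)
    }
    where
    ord : ∀ {n} → n ∈ ω → Ord n
    ord = ω-induction Ord ∅-ord (λ _ → ⁺-ord)

  ⁺-injective : ∀ {x y} → x ⁺ ≡ y ⁺ → x ≡ y
  ⁺-injective {x} {y} e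
    with to ∈-⁺ (subst (x ∈_) e self∈⁺) | to ∈-⁺ (subst (y ∈_) (sym e) self∈⁺)
  ... | inj₂ p | _      = p
  ... | inj₁ _ | inj₂ p = sym p
  ... | inj₁ p | inj₁ q = ⊥-elim (∈-asym p q)

  ∅≢⁺ : ∀ {x} → ∅ ≢ x ⁺
  ∅≢⁺ {x} e = ∉∅ (subst (x ∈_) (sym e) self∈⁺)

  -- The recursively defined function is the least set H ⊆ ω × A containing ⟨∅ , a⟩
  -- and closed under ⟨n , x⟩ ↦ ⟨n⁺ , F · x⟩: a pair violating single-valuedness could
  -- be removed from it.  The start ⟨∅ , a⟩ is a variable here because instance search finds
  -- a closed compound term definable in two ways.
  module Recursion {A F a ∅a : Carrier} (fun : Fun F A A) (a∈A : a ∈ A)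
                   (≡∅a : ⟨ ∅ , a ⟩ ≡ ∅a) where
    Closed : Carrier → Set ℓ
    Closed H = ∅a ∈ H × (∀ n x → n ∈ ω → x ∈ A → ⟨ n , x ⟩ ∈ H → ⟨ n ⁺ , F · x ⟩ ∈ H)

    iteration : Carrier
    iteration = sep (λ p → ∀ H → Closed H → p ∈ H) (ω ×ˢ A)

    zeroth : ⟨ ∅ , a ⟩ ∈ iteration
    zeroth = sep⁺ (from ⟨⟩∈×ˢ (∅∈ω , a∈A)) λ H c → subst (_∈ H) (sym ≡∅a) (proj₁ c)

    next : ∀ {n x} → ⟨ n , x ⟩ ∈ iteration → ⟨ n ⁺ , F · x ⟩ ∈ iteration
    next {n} {x} p = sep⁺ (from ⟨⟩∈×ˢ (⁺∈ω n∈ω , ·-cod fun x∈A))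
                          λ H c → proj₂ c n x n∈ω x∈A (sep⁻ p H c)
      where
      n∈ω = proj₁ (to ⟨⟩∈×ˢ (sep⊆ p))
      x∈A = proj₂ (to ⟨⟩∈×ˢ (sep⊆ p))

    -- If `p` is neither the start nor a successor pair, `iteration` without `p` is still closed,
    -- and leastness would put `p` into a set that omits it.
    irremovable : ∀ {p} → p ∈ iteration → ⟨ ∅ , a ⟩ ≢ p →
                  (∀ {n x} → ⟨ n , x ⟩ ∈ iteration → ⟨ n ⁺ , F · x ⟩ ≢ p) → p ∉ iteration
    irremovable {p} _ ne₀ ne₁ p∈ = sep⁻ (sep⁻ p∈ (sep (_≢ p) iteration)
      (subst (_∈ sep (_≢ p) iteration) ≡∅a (sep⁺ zeroth ne₀) ,
       λ _ _ _ _ q → sep⁺ (next (sep⊆ q)) (ne₁ (sep⊆ q)))) refl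

    single-valued : ∀ {n} → n ∈ ω → ∃[ x ] ⟨ n , x ⟩ ∈ iteration × (∀ y → ⟨ n , y ⟩ ∈ iteration → y ≡ x)
    single-valued = ω-induction
      (λ n → ∃[ x ] ⟨ n , x ⟩ ∈ iteration × (∀ y → ⟨ n , y ⟩ ∈ iteration → y ≡ x))
      (a , zeroth , λ y p → byContradiction λ y≢a → irremovable p
        (λ e → y≢a (sym (proj₂ (⟨⟩-injective e))))
        (λ _ e → ∅≢⁺ (sym (proj₁ (⟨⟩-injective e)))) p)
      -- A second value `y` at `n ⁺` could be removed: a pair leading to it would start from some
      -- `x′` at `n`, which is `x` by induction, and so would end at `F · x`.
      λ { n∈ω (x , p , u) → F · x , next p , λ y q → byContradiction λ y≢ → irremovable q
        (λ e → ∅≢⁺ (proj₁ (⟨⟩-injective e)))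
        (λ {_} {x′} r e → let (e₁ , e₂) = ⟨⟩-injective e in
          y≢ (trans (sym e₂) (cong (F ·_) (u x′
            (subst (λ k → ⟨ k , x′ ⟩ ∈ iteration) (⁺-injective e₁) r))))) q }

    iteration-fun : Fun iteration ω A
    iteration-fun = record
      { graph⊆ = sep⊆
      ; total  = λ n∈ω → let (x , p , _) = single-valued n∈ω in x , p
      ; unique = λ p q → let (_ , _ , u) = single-valued (proj₁ (to ⟨⟩∈×ˢ (sep⊆ p)))
                         in trans (u _ p) (sym (u _ q))
      }

  recursion : ∀ {A F a} → Fun F A A → a ∈ A →
              ∃[ h ] Fun h ω A × h · ∅ ≡ a × (∀ {n} → n ∈ ω → h · (n ⁺) ≡ F · (h · n))
  recursion fun a∈A =
    iteration , iteration-fun , ·-value iteration-fun zeroth ,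
    λ n∈ω → ·-value iteration-fun (next (·-graph iteration-fun n∈ω))
    where open Recursion fun a∈A refl

-- Countable sets, a pairing function on ω and the existence of ℵ₁.

module Countability {ℓ : Level} (em : ExcludedMiddle ℓ) (𝕍 : Structure ℓ) (zf : IsZF 𝕍) where
  open Structure 𝕍
  open Definability 𝕍
  open SetTheory em 𝕍 zf
  open Ordinals em 𝕍 zf
  open Fun
  open Inj
  open Ord

  -- Doubling is recursion along `m ↦ m ⁺ ⁺`, and the odd map is its successor. Disjointness and
  -- injectivity are inductions that cancel two successors on each side.
  evenOdd : ∃[ even ] ∃[ odd ] Inj even ω ω × Inj odd ω ω
                             × (∀ {m n} → m ∈ ω → n ∈ ω → even · m ≢ odd · n)
  evenOdd = d , rel ω ω (λ n m → m ≡ (d · n) ⁺) , record { fun = D ; injective = injective′ } , odd ,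
    λ p q e → even≢odd p _ q (trans e (·-value (odd .fun) (rel⁺ q (⁺∈ω (·-cod D q)) refl)))
    where
    step : Fun (rel ω ω λ m n → n ≡ m ⁺ ⁺) ω ω
    step = relFun (λ p → _ , ⁺∈ω (⁺∈ω p) , refl) (λ { _ _ _ refl refl → refl })

    iterated = recursion step ∅∈ω
    d = proj₁ iterated
    D = proj₁ (proj₂ iterated)

    d-∅ : d · ∅ ≡ ∅
    d-∅ = proj₁ (proj₂ (proj₂ iterated))

    d-⁺ : ∀ {n} → n ∈ ω → d · (n ⁺) ≡ (d · n) ⁺ ⁺
    d-⁺ p = trans (proj₂ (proj₂ (proj₂ iterated)) p)
                  (·-value step (rel⁺ (·-cod D p) (⁺∈ω (⁺∈ω (·-cod D p))) refl))

    even≢odd : ∀ {m} → m ∈ ω → ∀ n → n ∈ ω → d · m ≢ (d · n) ⁺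
    even≢odd = ω-induction (λ m → ∀ n → n ∈ ω → d · m ≢ (d · n) ⁺)
      (λ n _ e → ∅≢⁺ (trans (sym d-∅) e))
      λ {m} p h n q e → [ (λ { refl → ∅≢⁺ (sym (trans (⁺-injective (trans (sym (d-⁺ p)) e)) d-∅)) })
                        , (λ { (k , r , refl) → h k r
                             (⁺-injective (trans (⁺-injective (trans (sym (d-⁺ p)) e)) (d-⁺ r))) }) ]
                        (ω-cases q)

    inj : ∀ {m} → m ∈ ω → ∀ n → n ∈ ω → d · m ≡ d · n → m ≡ n
    inj = ω-induction (λ m → ∀ n → n ∈ ω → d · m ≡ d · n → m ≡ n)
      (λ n q e → [ sym
                 , (λ { (k , r , refl) → ⊥-elim (∅≢⁺ (trans (trans (sym d-∅) e) (d-⁺ r))) }) ]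
                 (ω-cases q))
      λ p h n q e → [ (λ { refl → ⊥-elim (∅≢⁺ (trans (sym d-∅) (trans (sym e) (d-⁺ p)))) })
                    , (λ { (k , r , refl) → cong _⁺ (h k r
                         (⁺-injective (⁺-injective (trans (sym (d-⁺ p)) (trans e (d-⁺ r)))))) }) ]
                    (ω-cases q)

    injective′ : ∀ {m n y} → ⟨ m , y ⟩ ∈ d → ⟨ n , y ⟩ ∈ d → m ≡ n
    injective′ p q = inj (dom D p) _ (dom D q) (trans (·-value D p) (sym (·-value D q)))

    odd : Inj (rel ω ω λ n m → m ≡ (d · n) ⁺) ω ω
    odd = relInj (λ p → _ , ⁺∈ω (·-cod D p) , refl) (λ { _ _ _ refl refl → refl })
                 (λ { p q _ refl e → inj p _ q (⁺-injective e) })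

  maps : Carrier
  maps = sep (λ g → Fun g ω ω) (𝒫 (ω ×ˢ ω))

  maps⁺ : ∀ {g} → Fun g ω ω → g ∈ maps
  maps⁺ G = sep⁺ (from ∈-𝒫 (graph⊆ G)) G

  maps⁻ : ∀ {g} → g ∈ maps → Fun g ω ω
  maps⁻ = sep⁻

  -- `recursion` iterates only functions that are sets. To iterate composition with `f`, this
  -- operation must itself be a set, acting on the set `maps` of all functions from ω to ω.
  postcompose : ∀ {f} → Fun f ω ω →
                ∃[ F ] Fun F maps maps
                     × (∀ {g} → g ∈ maps → ∀ n → n ∈ ω → (F · g) · n ≡ f · (g · n))
  postcompose {f} F = _ , step , λ p → rel⁻ (·-graph step p)
    where
    f∘ : ∀ {g} → g ∈ maps → ∃[ g′ ] g′ ∈ maps × (∀ n → n ∈ ω → g′ · n ≡ f · (g · n))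
    f∘ {g} g∈ = _ , maps⁺ G′ , λ n p → ·-value G′ (rel⁺ p (·-cod F (·-cod G p)) refl)
      where
      G : Fun g ω ω
      G = maps⁻ g∈
      G′ : Fun (rel ω ω λ n m → m ≡ f · (g · n)) ω ω
      G′ = relFun (λ p → _ , ·-cod F (·-cod G p) , refl) (λ { _ _ _ refl refl → refl })

    step : Fun (rel maps maps λ g g′ → ∀ n → n ∈ ω → g′ · n ≡ f · (g · n)) maps maps
    step = relFun f∘ λ _ q q′ e e′ →
      fun-ext (maps⁻ q) (maps⁻ q′) λ p → trans (e _ p) (sym (e′ _ p))

  module _ {even odd h : Carrier} (E : Inj even ω ω) (O : Inj odd ω ω)
           (disjoint : ∀ {m n} → m ∈ ω → n ∈ ω → even · m ≢ odd · n)
           (h∈ω : ∀ {n m} → n ∈ ω → m ∈ ω → (h · n) · m ∈ ω)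
           (h-∅ : ∀ {m} → m ∈ ω → (h · ∅) · m ≡ even · m)
           (h-⁺ : ∀ {n m} → n ∈ ω → m ∈ ω → (h · (n ⁺)) · m ≡ odd · ((h · n) · m)) where

    -- One application of `odd` is stripped from both sides at a time. If one side runs out first,
    -- `disjoint` refutes the equation; if both run out together, `even` is injective.
    iterates-injective : ∀ {n} → n ∈ ω → ∀ m n′ m′ → m ∈ ω → n′ ∈ ω → m′ ∈ ω →
                         (h · n) · m ≡ (h · n′) · m′ → n ≡ n′ × m ≡ m′
    iterates-injective = ω-induction
      (λ n → ∀ m n′ m′ → m ∈ ω → n′ ∈ ω → m′ ∈ ω → (h · n) · m ≡ (h · n′) · m′ → n ≡ n′ × m ≡ m′)
      zeroᶜ sucᶜ
      where
      zeroᶜ : ∀ m n′ m′ → m ∈ ω → n′ ∈ ω → m′ ∈ ω → (h · ∅) · m ≡ (h · n′) · m′ → ∅ ≡ n′ × m ≡ m′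
      zeroᶜ m n′ m′ q p′ q′ e with ω-cases p′
      ... | inj₁ refl = refl , ·-injective E q q′ (trans (sym (h-∅ q)) (trans e (h-∅ q′)))
      ... | inj₂ (k , r , refl) =
        ⊥-elim (disjoint q (h∈ω r q′) (trans (sym (h-∅ q)) (trans e (h-⁺ r q′))))

      sucᶜ : ∀ {n} → n ∈ ω →
             (∀ m n′ m′ → m ∈ ω → n′ ∈ ω → m′ ∈ ω → (h · n) · m ≡ (h · n′) · m′ → n ≡ n′ × m ≡ m′) →
             ∀ m n′ m′ → m ∈ ω → n′ ∈ ω → m′ ∈ ω → (h · (n ⁺)) · m ≡ (h · n′) · m′ → n ⁺ ≡ n′ × m ≡ m′
      sucᶜ p ih m n′ m′ q p′ q′ e with ω-cases p′
      ... | inj₁ refl = ⊥-elim (disjoint q′ (h∈ω p q) (trans (sym (h-∅ q′)) (trans (sym e) (h-⁺ p q))))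
      ... | inj₂ (k , r , refl)
        with e₁ , e₂ ← ih m k m′ q r q′ (·-injective O (h∈ω p q) (h∈ω r q′)
                         (trans (sym (h-⁺ p q)) (trans e (h-⁺ r q′)))) = cong _⁺ e₁ , e₂

  record Pairing (h : Carrier) : Set ℓ where
    field
      closed    : ∀ {n m} → n ∈ ω → m ∈ ω → (h · n) · m ∈ ω
      injective : ∀ {n m n′ m′} → n ∈ ω → m ∈ ω → n′ ∈ ω → m′ ∈ ω →
                  (h · n) · m ≡ (h · n′) · m′ → n ≡ n′ × m ≡ m′

  -- ⟨n , m⟩ ↦ (h · n) · m is the map ⟨n , m⟩ ↦ oddⁿ (even m), where even k = 2k and
  -- odd k = 2k + 1 are injections with disjoint ranges.
  pairing-exists : ∃[ h ] Pairing h
  pairing-exists = fromEvenOdd evenOdd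
    where
    fromIterates : ∀ {even odd step} → Inj even ω ω → Inj odd ω ω →
                   (∀ {m n} → m ∈ ω → n ∈ ω → even · m ≢ odd · n) →
                   (∀ {g} → g ∈ maps → ∀ n → n ∈ ω → (step · g) · n ≡ odd · (g · n)) →
                   (∃[ h ] Fun h ω maps × h · ∅ ≡ even × (∀ {n} → n ∈ ω → h · (n ⁺) ≡ step · (h · n))) →
                   ∃[ h ] Pairing h
    fromIterates E O disjoint spec (h , H , h-∅ , h-⁺) = h , record
      { closed    = h∈ω
      ; injective = λ p q p′ q′ → iterates-injective E O disjoint h∈ω
          (λ {m} _ → cong (_· m) h-∅)
          (λ {_} {m} p q → trans (cong (_· m) (h-⁺ p)) (spec (·-cod H p) _ q)) p _ _ _ q p′ q′
      }
      where
      h∈ω : ∀ {n m} → n ∈ ω → m ∈ ω → (h · n) · m ∈ ω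
      h∈ω p q = ·-cod (maps⁻ (·-cod H p)) q

    fromEvenOdd : (∃[ even ] ∃[ odd ] Inj even ω ω × Inj odd ω ω
                    × (∀ {m n} → m ∈ ω → n ∈ ω → even · m ≢ odd · n)) → ∃[ h ] Pairing h
    fromEvenOdd (_ , _ , E , O , disjoint) =
      let (_ , step , spec) = postcompose (O .fun)
      in fromIterates E O disjoint spec (recursion step (maps⁺ (E .fun)))

  -- The domain consists of ordinals, so sending each value to its least preimage gives a section
  -- without choice.
  range-≾ : ∀ {α S s X} → Ord α → S ⊆′ α → Fun s S X → range s S X ≾ S
  range-≾ {α} {S} {s} {X} o S⊆α F =
    rel (range s S X) S (λ y x → y ≡ s · x × (∀ z → z ∈ x → ¬ (z ∈ S × y ≡ s · z))) ,
    relInj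
      (λ {y} p → let (x , x∈S , e) = sep⁻ p
                     (m , _ , (m∈S , e′) , l) = least o (λ z → z ∈ S × y ≡ s · z) (x , S⊆α x∈S , x∈S , e)
                 in m , m∈S , e′ , l)
      (λ {y} _ q q′ (e , l) (e′ , l′) →
        least-unique o {λ z → z ∈ S × y ≡ s · z} (S⊆α q) (S⊆α q′) ((q , e) , l) ((q′ , e′) , l′))
      (λ { _ _ _ (e , _) (e′ , _) → trans e (sym e′) })

  -- Shifting all values of `g` up by one frees `∅` for the new element `α`.
  ⁺-countable : ∀ {α} → α ≾ ω → α ⁺ ≾ ω
  ⁺-countable {α} (g , G) =
    rel (α ⁺) ω (λ x n → (x ∈ α × n ≡ (g · x) ⁺) ⊎ (x ≡ α × n ≡ ∅)) ,
    relInj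
      (λ p → [ (λ q → _ , ⁺∈ω (·-cod (G .fun) q) , inj₁ (q , refl))
             , (λ q → _ , ∅∈ω , inj₂ (q , refl)) ] (to ∈-⁺ p))
      (λ { _ _ _ (inj₁ (_ , refl)) (inj₁ (_ , refl)) → refl
         ; _ _ _ (inj₁ (p , _)) (inj₂ (refl , _)) → ⊥-elim (∈-irrefl p)
         ; _ _ _ (inj₂ (refl , _)) (inj₁ (p , _)) → ⊥-elim (∈-irrefl p)
         ; _ _ _ (inj₂ (_ , refl)) (inj₂ (_ , refl)) → refl })
      (λ { _ _ _ (inj₁ (p , e)) (inj₁ (p′ , e′)) → ·-injective G p p′ (⁺-injective (trans (sym e) e′))
         ; _ _ _ (inj₁ (_ , e)) (inj₂ (_ , e′)) → ⊥-elim (∅≢⁺ (trans (sym e′) e))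
         ; _ _ _ (inj₂ (_ , e)) (inj₁ (_ , e′)) → ⊥-elim (∅≢⁺ (trans (sym e) e′))
         ; _ _ _ (inj₂ (e , _)) (inj₂ (e′ , _)) → trans e (sym e′) })

  record Aleph₁ (κ : Carrier) : Set ℓ where
    field
      ord         : Ord κ
      uncountable : ¬ κ ≾ ω
      countable   : ∀ {α} → α ∈ κ → α ≾ ω

  isAleph₁⇔ : ∀ {κ} → IsAleph₁ 𝕍 κ ⇔ Aleph₁ κ
  isAleph₁⇔ = mk⇔
    (λ (o , u , c) → record { ord = to isOrdinal⇔ o ; uncountable = λ h → u (from countable⇔ h)
                            ; countable = λ p → to countable⇔ (c _ p) })
    (λ A → from isOrdinal⇔ (Aleph₁.ord A) , (λ h → Aleph₁.uncountable A (to countable⇔ h)) ,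
           λ _ p → from countable⇔ (Aleph₁.countable A p))

  -- An injection g : α → ω transports the reflexive order of α to a relation r on ω,
  -- which determines α; so the countable ordinals form a set.
  record Code (r α g : Carrier) : Set ℓ where
    field
      inj      : Inj g α ω
      complete : ∀ {x y} → x ∈ α → y ∈ α → x ∈ y ⊎ x ≡ y → ⟨ g · x , g · y ⟩ ∈ r
      sound    : ∀ {p} → p ∈ r → ∃[ x ] ∃[ y ] x ∈ α × y ∈ α × (x ∈ y ⊎ x ≡ y) × p ≡ ⟨ g · x , g · y ⟩
  open Code

  instance
    def-Code : ∀ {r α g : Env → Carrier} → ⦃ DefT r ⦄ → ⦃ DefT α ⦄ → ⦃ DefT g ⦄ →
               Def (λ ρ → Code (r ρ) (α ρ) (g ρ))
    def-Code ⦃ dr ⦄ ⦃ dα ⦄ ⦃ dg ⦄ = def-atom₃ Code (def-resp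
      {P = λ ρ → Inj (ρ 2) (ρ 1) ω
               × (∀ x y → x ∈ ρ 1 → y ∈ ρ 1 → x ∈ y ⊎ x ≡ y → ⟨ ρ 2 · x , ρ 2 · y ⟩ ∈ ρ 0)
               × (∀ p → p ∈ ρ 0 → ∃[ x ] ∃[ y ] x ∈ ρ 1 × y ∈ ρ 1 × (x ∈ y ⊎ x ≡ y)
                                                × p ≡ ⟨ ρ 2 · x , ρ 2 · y ⟩)}
      (λ _ → mk⇔ (λ (i , c , s) → record { inj = i ; complete = c _ _ ; sound = s _ })
                 (λ C → C .inj , (λ _ _ → C .complete) , λ _ → C .sound))
      it) dr dα dg

  -- Both codings describe the same `r`: the pair that `z` and `x` contribute through `g` is read
  -- back through `g′`, where injectivity forces its second entry to be `x′`.
  code-lower : ∀ {r α g α′ g′} → Code r α g → Code r α′ g′ → ∀ {x x′ z} → x ∈ α → x′ ∈ α′ →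
               g · x ≡ g′ · x′ → z ∈ α → z ∈ x ⊎ z ≡ x →
               ∃[ z′ ] z′ ∈ α′ × (z′ ∈ x′ ⊎ z′ ≡ x′) × g · z ≡ g′ · z′
  code-lower C C′ x∈α x′∈α′ e z∈α z≤x
    with z′ , y′ , z′∈α′ , y′∈α′ , z′≤y′ , e′ ← C′ .sound (C .complete z∈α x∈α z≤x)
    with e₁ , e₂ ← ⟨⟩-injective e′
    with refl ← ·-injective (C′ .inj) y′∈α′ x′∈α′ (trans (sym e₂) e) = z′ , z′∈α′ , z′≤y′ , e₁

  module _ {r α g α′ g′ : Carrier} (o : Ord α) (o′ : Ord α′) (C : Code r α g) (C′ : Code r α′ g′) where
    -- By `code-lower`, elements with the same code have predecessors with the same codes. These
    -- agree by induction, and extensionality finishes.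
    code-rigid : ∀ {x} → x ∈ α → ∀ x′ → x′ ∈ α′ → g · x ≡ g′ · x′ → x ≡ x′
    code-rigid = ord-induction o (λ x → ∀ x′ → x′ ∈ α′ → g · x ≡ g′ · x′ → x ≡ x′) step
      where
      step : ∀ {x} → x ∈ α → (∀ {y} → y ∈ x → ∀ y′ → y′ ∈ α′ → g · y ≡ g′ · y′ → y ≡ y′) →
             ∀ x′ → x′ ∈ α′ → g · x ≡ g′ · x′ → x ≡ x′
      step {x} x∈α ih x′ x′∈α′ e = ⊆-antisym forward backward
        where
        forward : x ⊆′ x′
        forward z∈x with z∈α ← o .transitive z∈x x∈α
          with code-lower C C′ x∈α x′∈α′ e z∈α (inj₁ z∈x)
        ... | z′ , z′∈α′ , inj₁ z′∈x′ , e′ = subst (_∈ x′) (sym (ih z∈x z′ z′∈α′ e′)) z′∈x′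
        ... | _ , _ , inj₂ refl , e′ = ⊥-elim (∈-irrefl
          (subst (_∈ x) (·-injective (C .inj) z∈α x∈α (trans e′ (sym e))) z∈x))

        backward : x′ ⊆′ x
        backward z′∈x′ with z′∈α′ ← o′ .transitive z′∈x′ x′∈α′
          with code-lower C′ C x′∈α′ x∈α (sym e) z′∈α′ (inj₁ z′∈x′)
        ... | z , z∈α , inj₁ z∈x , e′ = subst (_∈ x) (ih z∈x _ z′∈α′ (sym e′)) z∈x
        ... | _ , _ , inj₂ refl , e′ = ⊥-elim (∈-irrefl
          (subst (_∈ x′) (·-injective (C′ .inj) z′∈α′ x′∈α′ (trans e′ e)) z′∈x′))

    -- Here the order must be reflexive: the diagonal pair of `x` records `g · x` in `r` even when
    -- `x` is comparable to nothing else, and so gives `x` a partner in `α′`.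
    code-⊆ : α ⊆′ α′
    code-⊆ x∈α with y , _ , y∈α′ , _ , _ , e ← C′ .sound (C .complete x∈α x∈α (inj₂ refl)) =
      subst (_∈ α′) (sym (code-rigid x∈α y y∈α′ (proj₁ (⟨⟩-injective e)))) y∈α′

  ≾-⊆ : ∀ {X Y Z} → X ⊆′ Y → Y ≾ Z → X ≾ Z
  ≾-⊆ p = ≾-trans (⊆⇒≾ p)

  encode : ∀ {α g} → Inj g α ω → ∃[ r ] r ∈ 𝒫 (ω ×ˢ ω) × Code r α g
  encode {α} {g} G = r , from ∈-𝒫 sep⊆ , record
    { inj = G
    ; complete = λ p q h → sep⁺ (from ⟨⟩∈×ˢ (·-cod (G .fun) p , ·-cod (G .fun) q)) (_ , _ , p , q , h , refl)
    ; sound = sep⁻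
    }
    where
    r = sep (λ p → ∃[ x ] ∃[ y ] x ∈ α × y ∈ α × (x ∈ y ⊎ x ≡ y) × p ≡ ⟨ g · x , g · y ⟩) (ω ×ˢ ω)

  -- Hartogs' construction: κ is the set of all countable ordinals, obtained by replacement over the
  -- relations on ω since a relation codes at most one ordinal. If κ were countable, it would be its
  -- own element.
  aleph₁-exists : ∃[ κ ] Aleph₁ κ
  aleph₁-exists = countableOrdinals⇒ (replace (λ r α → Ord α × (∃[ g ] Code r α g)) (𝒫 (ω ×ˢ ω))
    λ _ (o , _ , C) (o′ , _ , C′) → ⊆-antisym (code-⊆ o o′ C C′) (code-⊆ o′ o C′ C))
    where
    countableOrdinals⇒ : ∃[ κ ] (∀ {α} → α ∈ κ ⇔ (∃[ r ] r ∈ 𝒫 (ω ×ˢ ω) × Ord α × (∃[ g ] Code r α g))) →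
                         ∃[ κ ] Aleph₁ κ
    countableOrdinals⇒ (κ , ∈κ) =
      κ , record { ord = κ-ord ; uncountable = λ h → ∈-irrefl (member κ-ord h) ; countable = countable }
      where
      member : ∀ {α} → Ord α → α ≾ ω → α ∈ κ
      member o (g , G) = let (r , r∈ , C) = encode G in from ∈κ (r , r∈ , o , g , C)

      element-ord : ∀ {α} → α ∈ κ → Ord α
      element-ord p = proj₁ (proj₂ (proj₂ (to ∈κ p)))

      countable : ∀ {α} → α ∈ κ → α ≾ ω
      countable p = let (_ , _ , _ , g , C) = to ∈κ p in g , C .inj

      κ-ord : Ord κ
      κ-ord = record
        { transitive = λ x∈y y∈κ → member (∈-ord (element-ord y∈κ) x∈y)
            (≾-⊆ (λ z∈x → element-ord y∈κ .transitive z∈x x∈y) (countable y∈κ))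
        ; compare = λ p q → ord-compare (element-ord p) (element-ord q)
        }

-- Regularity of ℵ₁ and the consequences of `DC-ℵ₁`.

module Regularity {ℓ : Level} (em : ExcludedMiddle ℓ) (𝕍 : Structure ℓ) (zf : IsZF 𝕍) where
  open Structure 𝕍
  open Definability 𝕍
  open SetTheory em 𝕍 zf
  open Ordinals em 𝕍 zf
  open Countability em 𝕍 zf
  open Fun
  open Inj
  open Ord
  open Aleph₁
  open Pairing

  Unbounded : Carrier → Carrier → Set ℓ
  Unbounded κ X = ∀ β → β ∈ κ → ∃[ x ] x ∈ X × β ∈ x

  Regular : Carrier → Set ℓ
  Regular κ = ∀ {A} → A ⊆′ κ → A ≾ ω → ¬ Unbounded κ A

  -- A countable cofinal `A` is itself the forbidden family: its members are countable sets of
  -- ordinals, and unboundedness makes their union κ.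
  ℵ₁-regular⇒Regular : ℵ₁-regular 𝕍 → ∀ {κ} → Aleph₁ κ → Regular κ
  ℵ₁-regular⇒Regular reg {κ} K {A} A⊆κ A≾ω unb = reg κ (from isAleph₁⇔ K)
    ( A , from countable⇔ A≾ω
    , (λ a a∈A → from countable⇔ (K .countable (A⊆κ a∈A)) ,
                 λ α α∈a → from isOrdinal⇔ (∈-ord (K .ord) (K .ord .transitive α∈a (A⊆κ a∈A))))
    , λ z → mk⇔ (unb z) (λ (a , a∈A , z∈a) → K .ord .transitive z∈a (A⊆κ a∈A)) )

  module _ (dc : DC-ℵ₁ 𝕍) {κ : Carrier} (K : Aleph₁ κ) where

    -- `DC-ℵ₁` takes its relation as a set, so `Q` is first restricted to `𝒫 (κ ×ˢ S)`, which
    -- contains all functions into `S` from elements of κ.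
    dc-sequence : ∀ {S} (Q : Carrier → Carrier → Set ℓ)
                  ⦃ d : Def (λ ρ → ∃ λ s → ∃ λ y → ρ 0 ≡ ⟨ s , y ⟩ × Q s y) ⦄ → IsNonempty 𝕍 S →
                  (∀ {β s} → β ∈ κ → Fun s β S → ∃[ y ] y ∈ S × Q s y) →
                  ∃[ f ] Fun f κ S × (∀ {β} → β ∈ κ →
                    ∃[ s ] Fun s β S × (∀ {x} → x ∈ β → ⟨ x , f · x ⟩ ∈ s) × Q s (f · β))
    dc-sequence {S} Q ⦃ d ⦄ nonempty extend =
      convert (dc κ (from isAleph₁⇔ K) S R nonempty λ β β∈κ s isF →
        let F = to isFunction⇔ isF
            (y , y∈S , q) = extend β∈κ F
        in y , y∈S , from related⇔ (rel⁺ {P = Q} ⦃ d ⦄ (s∈𝒫 β∈κ F) y∈S q))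
      where
      R = rel (𝒫 (κ ×ˢ S)) S Q ⦃ d ⦄

      s∈𝒫 : ∀ {β s} → β ∈ κ → Fun s β S → s ∈ 𝒫 (κ ×ˢ S)
      s∈𝒫 β∈κ F = from ∈-𝒫 λ p → let (x , y , x∈β , y∈S , e) = to ∈-×ˢ (F .graph⊆ p)
                                  in from ∈-×ˢ (x , y , K .ord .transitive x∈β β∈κ , y∈S , e)

      convert : (∃[ f ] IsFunction 𝕍 f κ S × (∀ β → β ∈ κ →
                  ∃[ s ] ∃[ y ] IsRestriction 𝕍 s f β × Related 𝕍 f β y × Related 𝕍 R s y)) →
                ∃[ f ] Fun f κ S × (∀ {β} → β ∈ κ →
                  ∃[ s ] Fun s β S × (∀ {x} → x ∈ β → ⟨ x , f · x ⟩ ∈ s) × Q s (f · β))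
      convert (f , isF , h) = f , F , λ β∈κ → step β∈κ (h _ β∈κ)
        where
        F = to isFunction⇔ isF
        step : ∀ {β} → β ∈ κ →
               (∃[ s ] ∃[ y ] IsRestriction 𝕍 s f β × Related 𝕍 f β y × Related 𝕍 R s y) →
               ∃[ s ] Fun s β S × (∀ {x} → x ∈ β → ⟨ x , f · x ⟩ ∈ s) × Q s (f · β)
        step {β} β∈κ (s , y , res , fβ , r) = s , G , graph , subst (Q s) (sym (·-value F (to related⇔ fβ)))
                                                                 (rel⁻ {P = Q} ⦃ d ⦄ (to related⇔ r))
          where
          graph : ∀ {x} → x ∈ β → ⟨ x , f · x ⟩ ∈ s
          graph x∈β = from (res _)
            (·-graph F (K .ord .transitive x∈β β∈κ) , _ , _ , x∈β , from isOrderedPair⇔ refl)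
          G : Fun s β S
          G .graph⊆ p with p∈f , x , y′ , x∈β , op ← to (res _) p with refl ← to isOrderedPair⇔ op =
            from ⟨⟩∈×ˢ (x∈β , cod F p∈f)
          G .total x∈β = _ , graph x∈β
          G .unique p q = F .unique (proj₁ (to (res _) p)) (proj₁ (to (res _) q))

    uncountable-nonempty : ∀ {X} → ¬ X ≾ ω → IsNonempty 𝕍 X
    uncountable-nonempty unc = byContradiction λ empty → unc (⊆⇒≾ λ x∈X → ⊥-elim (empty (_ , x∈X)))

    dc-≾ : ∀ {X} → ¬ X ≾ ω → κ ≾ X
    dc-≾ {X} unc = convert (dc-sequence {X} (λ s y → ∀ x → ⟨ x , y ⟩ ∉ s) (uncountable-nonempty unc) fresh)
      where
      fresh : ∀ {β s} → β ∈ κ → Fun s β X → ∃[ y ] y ∈ X × (∀ x → ⟨ x , y ⟩ ∉ s)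
      -- If nothing were fresh, `X` would lie in the range of `s`, which injects into the countable
      -- ordinal `β`.
      fresh {β} {s} β∈κ F = byContradiction λ ¬ex → unc (≾-trans
        (⊆⇒≾ λ {y} y∈X → sep⁺ y∈X (byContradiction λ y∉ → ¬ex
          (y , y∈X , λ x p → y∉ (x , dom F p , sym (·-value F p)))))
        (≾-trans (range-≾ (∈-ord (K .ord) β∈κ) id F) (K .countable β∈κ)))

      convert : (∃[ f ] Fun f κ X × (∀ {β} → β ∈ κ →
                  ∃[ s ] Fun s β X × (∀ {x} → x ∈ β → ⟨ x , f · x ⟩ ∈ s) × (∀ x → ⟨ x , f · β ⟩ ∉ s))) →
                κ ≾ X
      convert (f , F , h) = f , record
        { fun = F
        ; injective = λ p q → injective′ (dom F p) (dom F q) (trans (·-value F p) (sym (·-value F q)))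
        }
        where
        distinct : ∀ {α β} → β ∈ κ → α ∈ β → f · α ≢ f · β
        distinct {α} β∈κ α∈β e = let (s , _ , graph , q) = h β∈κ in
          q α (subst (λ y → ⟨ α , y ⟩ ∈ s) e (graph α∈β))
        injective′ : ∀ {α β} → α ∈ κ → β ∈ κ → f · α ≡ f · β → α ≡ β
        injective′ p q e with K .ord .compare p q
        ... | inj₁ α∈β = ⊥-elim (distinct q α∈β e)
        ... | inj₂ (inj₁ α≡β) = α≡β
        ... | inj₂ (inj₂ β∈α) = ⊥-elim (distinct p β∈α (sym e))

    dom-unique : ∀ {s X X′ Y Y′} → Fun s X Y → Fun s X′ Y′ → X ≡ X′
    dom-unique F F′ = ⊆-antisym (λ p → dom F′ (·-graph F p)) (λ p → dom F (·-graph F′ p))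

    -- The relation handed to dependent choice sees the sequence but not the stage. The stage is the
    -- domain of the sequence, so the relation names some `β` with `Fun s β S`, and `dom-unique`
    -- identifies it.
    dc-enumerations : ∃[ G ] (∀ {β} → β ∈ κ → Inj (G · β) β ω)
    dc-enumerations = convert
      (dc-sequence {S} (λ s y → ∃[ β ] β ∈ κ × Fun s β S × Inj y β ω) nonempty extend)
      where
      S = sep (λ g → ∃[ α ] α ∈ κ × Inj g α ω) (𝒫 (κ ×ˢ ω))

      S⁺ : ∀ {α} → α ∈ κ → ∃[ g ] g ∈ S × Inj g α ω
      S⁺ α∈κ = let (g , G) = K .countable α∈κ in
        g , sep⁺ (from ∈-𝒫 λ p → let (x , y , x∈α , y∈ω , e) = to ∈-×ˢ (G .fun .graph⊆ p)
                                 in from ∈-×ˢ (x , y , K .ord .transitive x∈α α∈κ , y∈ω , e))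
                 (_ , α∈κ , G) , G

      nonempty : IsNonempty 𝕍 S
      nonempty = let (_ , α∈κ) = uncountable-nonempty (K .uncountable)
                     (g , g∈S , _) = S⁺ α∈κ
                 in g , g∈S

      extend : ∀ {β s} → β ∈ κ → Fun s β S → ∃[ y ] y ∈ S × (∃[ α ] α ∈ κ × Fun s α S × Inj y α ω)
      extend {β} β∈κ F = let (g , g∈S , G) = S⁺ β∈κ in g , g∈S , β , β∈κ , F , G

      convert : (∃[ f ] Fun f κ S × (∀ {β} → β ∈ κ → ∃[ s ] Fun s β S
                  × (∀ {x} → x ∈ β → ⟨ x , f · x ⟩ ∈ s) × (∃[ α ] α ∈ κ × Fun s α S × Inj (f · β) α ω))) →
                ∃[ G ] (∀ {β} → β ∈ κ → Inj (G · β) β ω)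
      convert (f , _ , h) = f , λ β∈κ → let (s , Fβ , _ , α , _ , Fα , I) = h β∈κ in
        subst (λ γ → Inj _ γ ω) (dom-unique Fα Fβ) I

    -- ξ ↦ ⟨a , ξ⟩, with a the least element of A above ξ, injects κ into the countable
    -- union of the elements of A.
    dc-regular : Regular κ
    dc-regular {A} A⊆κ (e , E) unb = K .uncountable (fromChoices pairing-exists dc-enumerations)
      where
      fromChoices : (∃[ h ] Pairing h) → (∃[ G ] (∀ {β} → β ∈ κ → Inj (G · β) β ω)) → κ ≾ ω
      fromChoices (h , H) (G , GI) =
        rel κ ω (λ ξ n → ∃[ a ] (a ∈ A × ξ ∈ a) × (∀ b → b ∈ a → ¬ (b ∈ A × ξ ∈ b))
                              × n ≡ (h · (e · a)) · ((G · a) · ξ)) ,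
        relInj
          (λ {ξ} ξ∈κ → let (a , a∈A , ξ∈a) = unb ξ ξ∈κ
                           (m , _ , (m∈A , ξ∈m) , l) =
                             least (K .ord) (λ a → a ∈ A × ξ ∈ a) (a , A⊆κ a∈A , a∈A , ξ∈a)
                       in _ , H .closed (e∈ω m∈A) (G∈ω m∈A ξ∈m) , m , (m∈A , ξ∈m) , l , refl)
          (λ { {ξ} _ _ _ (a , (a∈A , ξ∈a) , l , refl) (a′ , (a′∈A , ξ∈a′) , l′ , refl) →
               cong (λ a → (h · (e · a)) · ((G · a) · ξ))
                 (least-unique (K .ord) {λ a → a ∈ A × ξ ∈ a} (A⊆κ a∈A) (A⊆κ a′∈A)
                               ((a∈A , ξ∈a) , l) ((a′∈A , ξ∈a′) , l′)) })
          (λ { _ _ _ (a , (a∈A , ξ∈a) , _ , refl) (a′ , (a′∈A , ξ′∈a′) , _ , q) →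
               let (e₁ , e₂) = H .injective (e∈ω a∈A) (G∈ω a∈A ξ∈a) (e∈ω a′∈A) (G∈ω a′∈A ξ′∈a′) q
               in same (·-injective E a∈A a′∈A e₁) a∈A ξ∈a ξ′∈a′ e₂ })
        where
        e∈ω : ∀ {a} → a ∈ A → e · a ∈ ω
        e∈ω = ·-cod (E .fun)
        G∈ω : ∀ {a ξ} → a ∈ A → ξ ∈ a → (G · a) · ξ ∈ ω
        G∈ω a∈A = ·-cod (GI (A⊆κ a∈A) .fun)
        same : ∀ {a a′ ξ ξ′} → a ≡ a′ → a ∈ A → ξ ∈ a → ξ′ ∈ a′ → (G · a) · ξ ≡ (G · a′) · ξ′ → ξ ≡ ξ′
        same refl a∈A = ·-injective (GI (A⊆κ a∈A))

-- Unbounded independent sets and infinite cliques in graphs on ℵ₁.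

module Partition {ℓ : Level} (em : ExcludedMiddle ℓ) (𝕍 : Structure ℓ) (zf : IsZF 𝕍) where
  open Structure 𝕍
  open Definability 𝕍
  open SetTheory em 𝕍 zf
  open Ordinals em 𝕍 zf
  open Countability em 𝕍 zf
  open Regularity em 𝕍 zf
  open Fun
  open Inj
  open Ord
  open Aleph₁

  module _ {κ : Carrier} (K : Aleph₁ κ) (reg : Regular κ) where

    bounded⇒countable : ∀ {X β} → X ⊆′ κ → β ∈ κ → (∀ {x} → x ∈ X → β ∉ x) → X ≾ ω
    -- The bound is not strict: `β` itself may belong to `X`, hence the successor.
    bounded⇒countable {X} {β} X⊆κ β∈κ bound = ≾-⊆ X⊆β⁺ (⁺-countable (K .countable β∈κ))
      where
      X⊆β⁺ : X ⊆′ β ⁺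
      X⊆β⁺ x∈X with K .ord .compare (X⊆κ x∈X) β∈κ
      ... | inj₁ x∈β = ⊆⁺ x∈β
      ... | inj₂ (inj₁ refl) = self∈⁺
      ... | inj₂ (inj₂ β∈x) = ⊥-elim (bound x∈X β∈x)

    ¬unbounded⇒bounded : ∀ {X} → ¬ Unbounded κ X → ∃[ β ] β ∈ κ × (∀ {x} → x ∈ X → β ∉ x)
    ¬unbounded⇒bounded ¬unb = let (β , β∈κ , ¬ex) = ¬∀⇒∃¬ ¬unb in β , β∈κ , λ x∈X β∈x → ¬ex (_ , x∈X , β∈x)

    uncountable⇒unbounded : ∀ {X} → X ⊆′ κ → ¬ X ≾ ω → Unbounded κ X
    uncountable⇒unbounded X⊆κ unc = byContradiction λ ¬unb →
      let (_ , β∈κ , bound) = ¬unbounded⇒bounded ¬unb in unc (bounded⇒countable X⊆κ β∈κ bound)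

    above-both : ∀ {X β δ} → X ⊆′ κ → Unbounded κ X → β ∈ κ → δ ∈ κ → ∃[ α ] α ∈ X × β ∈ α × δ ∈ α
    above-both {X} {β} {δ} X⊆κ unb β∈κ δ∈κ with K .ord .compare β∈κ δ∈κ
    ... | inj₁ β∈δ = let (α , α∈X , δ∈α) = unb δ δ∈κ
                     in α , α∈X , ∈-ord (K .ord) (X⊆κ α∈X) .transitive β∈δ δ∈α , δ∈α
    ... | inj₂ (inj₁ refl) = let (α , α∈X , β∈α) = unb β β∈κ in α , α∈X , β∈α , β∈α
    ... | inj₂ (inj₂ δ∈β) = let (α , α∈X , β∈α) = unb β β∈κ
                            in α , α∈X , β∈α , ∈-ord (K .ord) (X⊆κ α∈X) .transitive δ∈β β∈α

    module _ {E : Carrier} (E-sym : ∀ {x y} → ⟨ x , y ⟩ ∈ E → ⟨ y , x ⟩ ∈ E)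
             (E-irrefl : ∀ {x} → ⟨ x , x ⟩ ∉ E) where

      opaque
        neighbours : Carrier → Carrier → Carrier
        neighbours X x = sep (λ y → ⟨ x , y ⟩ ∈ E) X

        ∈-neighbours : ∀ {X x y} → y ∈ neighbours X x ⇔ (y ∈ X × ⟨ x , y ⟩ ∈ E)
        ∈-neighbours = ∈-sep _ _

      Independent : Carrier → Set ℓ
      Independent S = ∀ x y → x ∈ S → y ∈ S → ⟨ x , y ⟩ ∉ E

      -- The greedy independent subset of X consists of those α ∈ X not adjacent to any
      -- smaller element of it.  It is the union of the sets t that are built greedily up
      -- to sup t, any two of which are comparable.
      module GreedyIndependent {X : Carrier} (X⊆κ : X ⊆′ κ) where

        Greedy : Carrier → Set ℓ
        Greedy t = Independent t × (∀ α τ → α ∈ X → τ ∈ t → α ∈ τ →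
                     α ∈ t ⊎ (∃[ γ ] γ ∈ t × γ ∈ α × ⟨ γ , α ⟩ ∈ E))

        opaque
          greedy : Carrier
          greedy = sep (λ α → ∃[ t ] t ∈ 𝒫 X × Greedy t × α ∈ t) X

          greedy⊆ : greedy ⊆′ X
          greedy⊆ = sep⊆

          greedy⁻ : ∀ {α} → α ∈ greedy → ∃[ t ] t ⊆′ X × Greedy t × α ∈ t
          greedy⁻ p = let (t , t∈ , g , α∈t) = sep⁻ p in t , to ∈-𝒫 t∈ , g , α∈t

          greedy⁺ : ∀ {α t} → t ⊆′ X → Greedy t → α ∈ t → α ∈ greedy
          greedy⁺ t⊆X g α∈t = sep⁺ (t⊆X α∈t) (_ , from ∈-𝒫 t⊆X , g , α∈t)

        Downward : Carrier → Carrier → Carrier → Set ℓ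
        Downward t t′ α = α ∈ t → ∀ τ → τ ∈ t′ → α ∈ τ → α ∈ t′

        -- Had `t′` rejected `α`, it would contain a smaller neighbour `γ` of `α`. The hypothesis
        -- with the roles exchanged puts `γ` into `t`, next to `α`, against independence.
        downward : ∀ {t t′ α} → t ⊆′ X → Greedy t → Greedy t′ →
                   (∀ {γ} → γ ∈ α → Downward t′ t γ) → Downward t t′ α
        downward t⊆X (ind , _) (_ , maximal) ih α∈t τ τ∈t′ α∈τ with maximal _ τ (t⊆X α∈t) τ∈t′ α∈τ
        ... | inj₁ α∈t′ = α∈t′
        ... | inj₂ (γ , γ∈t′ , γ∈α , adj) = ⊥-elim (ind γ _ (ih γ∈α γ∈t′ _ α∈t γ∈α) α∈t adj)

        -- Each direction uses the other at smaller ordinals, so one induction proves both.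
        coherent : ∀ {t t′} → t ⊆′ X → t′ ⊆′ X → Greedy t → Greedy t′ → ∀ {α} → α ∈ t → Downward t t′ α
        coherent {t} {t′} t⊆X t′⊆X g g′ α∈t = proj₁ (ord-induction (K .ord)
          (λ α → (α ∈ t → ∀ τ → τ ∈ t′ → α ∈ τ → α ∈ t′) × (α ∈ t′ → ∀ τ → τ ∈ t → α ∈ τ → α ∈ t))
          (λ _ ih → downward t⊆X g g′ (λ γ∈α → proj₂ (ih γ∈α)) , downward t′⊆X g′ g (λ γ∈α → proj₁ (ih γ∈α)))
          (X⊆κ (t⊆X α∈t)))

        greedy-independent : Independent greedy
        greedy-independent x y x∈ y∈ adj
          with t , t⊆X , g , x∈t ← greedy⁻ x∈ | t′ , t′⊆X , g′ , y∈t′ ← greedy⁻ y∈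
          with K .ord .compare (X⊆κ (t⊆X x∈t)) (X⊆κ (t′⊆X y∈t′))
        ... | inj₁ x∈y = proj₁ g′ x y (coherent t⊆X t′⊆X g g′ x∈t x∈t y y∈t′ x∈y) y∈t′ adj
        ... | inj₂ (inj₁ refl) = E-irrefl adj
        ... | inj₂ (inj₂ y∈x) = proj₁ g x y x∈t (coherent t′⊆X t⊆X g′ g y∈t′ y∈t′ x x∈t y∈x) adj

        -- If the given neighbour `γ` lies above `β`, an approximation containing `γ` has already
        -- decided about `β`; it can only have rejected `β` because of a smaller neighbour.
        lower-neighbour : ∀ {β γ} → β ∈ X → β ∉ greedy → γ ∈ greedy → ⟨ γ , β ⟩ ∈ E →
                          ∃[ δ ] δ ∈ greedy × δ ∈ β × ⟨ δ , β ⟩ ∈ E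
        lower-neighbour {β} {γ} β∈X β∉ γ∈ adj
          with t , t⊆X , g , γ∈t ← greedy⁻ γ∈ with K .ord .compare (X⊆κ (t⊆X γ∈t)) (X⊆κ β∈X)
        ... | inj₁ γ∈β = γ , γ∈ , γ∈β , adj
        ... | inj₂ (inj₁ refl) = ⊥-elim (E-irrefl adj)
        ... | inj₂ (inj₂ β∈γ) with proj₂ g β γ β∈X γ∈t β∈γ
        ... | inj₁ β∈t = ⊥-elim (β∉ (greedy⁺ t⊆X g β∈t))
        ... | inj₂ (δ , δ∈t , δ∈β , adj′) = δ , greedy⁺ t⊆X g δ∈t , δ∈β , adj′

        Unreached : Carrier → Set ℓ
        Unreached α = α ∈ X × α ∉ greedy × (∀ γ → γ ∈ greedy → ⟨ γ , α ⟩ ∉ E)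

        module _ {α t : Carrier} (unreached : Unreached α) (l : ∀ β → β ∈ α → ¬ Unreached β)
                 (∈-t : ∀ {z} → z ∈ t ⇔ (z ∈ X × ((z ∈ greedy × z ∈ α) ⊎ z ≡ α))) where
          private
            α∈X  = proj₁ unreached
            free = proj₂ (proj₂ unreached)

            α-transitive : ∀ {β τ} → β ∈ τ → τ ∈ α → β ∈ α
            α-transitive = ∈-ord (K .ord) (X⊆κ α∈X) .transitive

            below : ∀ {β τ} → β ∈ τ → τ ∈ t → β ∈ α
            below β∈τ τ∈t = [ (λ (_ , τ∈α) → α-transitive β∈τ τ∈α) , (λ { refl → β∈τ }) ] (proj₂ (to ∈-t τ∈t))

          extension-independent : Independent t
          extension-independent x y x∈t y∈t adj with proj₂ (to ∈-t x∈t) | proj₂ (to ∈-t y∈t)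
          ... | inj₁ (p , _) | inj₁ (q , _) = greedy-independent x y p q adj
          ... | inj₁ (p , _) | inj₂ refl = free x p adj
          ... | inj₂ refl | inj₁ (q , _) = free y q (E-sym adj)
          ... | inj₂ refl | inj₂ refl = E-irrefl adj

          -- Here `t` is the part of `greedy` below `α` together with `α`. By leastness of `α`, a
          -- rejected `β` below it has a neighbour in `greedy`, and `lower-neighbour` finds one
          -- below `β`, hence in `t`. So `t` is an approximation, which forces `α` into `greedy`.
          extension-greedy : Greedy t
          extension-greedy = extension-independent , maximal
            where
            maximal : ∀ β τ → β ∈ X → τ ∈ t → β ∈ τ → β ∈ t ⊎ (∃[ γ ] γ ∈ t × γ ∈ β × ⟨ γ , β ⟩ ∈ E)
            maximal β τ β∈X τ∈t β∈τ with em {β ∈ greedy}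
            ... | yes β∈ = inj₁ (from ∈-t (β∈X , inj₁ (β∈ , below β∈τ τ∈t)))
            ... | no β∉ = inj₂ (lower (byContradiction λ ¬ex →
                    l β (below β∈τ τ∈t) (β∈X , β∉ , λ γ γ∈ adj → ¬ex (γ , γ∈ , adj))))
              where
              lower : (∃[ γ ] γ ∈ greedy × ⟨ γ , β ⟩ ∈ E) → ∃[ γ ] γ ∈ t × γ ∈ β × ⟨ γ , β ⟩ ∈ E
              lower (γ , γ∈ , adj) = let (δ , δ∈ , δ∈β , adj′) = lower-neighbour β∈X β∉ γ∈ adj in
                δ , from ∈-t (greedy⊆ δ∈ , inj₁ (δ∈ , α-transitive δ∈β (below β∈τ τ∈t))) , δ∈β , adj′

        least-unreached-impossible : ∀ {α} → Unreached α → ¬ (∀ β → β ∈ α → ¬ Unreached β)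
        least-unreached-impossible {α} u@(α∈X , α∉ , _) l =
          α∉ (greedy⁺ (λ z∈t → proj₁ (to ∈-t z∈t)) (extension-greedy u l ∈-t) (from ∈-t (α∈X , inj₂ refl)))
          where
          ∈-t : ∀ {z} → z ∈ sep (λ z → (z ∈ greedy × z ∈ α) ⊎ z ≡ α) X
                      ⇔ (z ∈ X × ((z ∈ greedy × z ∈ α) ⊎ z ≡ α))
          ∈-t = ∈-sep (λ z → (z ∈ greedy × z ∈ α) ⊎ z ≡ α) X

        greedy-maximal : ∀ {α} → α ∈ X → α ∉ greedy → ∃[ γ ] γ ∈ greedy × ⟨ γ , α ⟩ ∈ E
        greedy-maximal α∈X α∉ = byContradiction λ ¬ex →
          let (_ , _ , unreached , l) = least (K .ord)
                (λ α → α ∈ X × α ∉ greedy × (∀ γ → γ ∈ greedy → ⟨ γ , α ⟩ ∉ E))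
                (_ , X⊆κ α∈X , α∈X , α∉ , λ γ γ∈ adj → ¬ex (γ , γ∈ , adj))
          in least-unreached-impossible unreached l

        -- If greedy were bounded, it would be countable, and by regularity some δ would bound
        -- the neighbourhoods of all its elements; then nothing in X above δ is adjacent to it.
        module _ (unb : Unbounded κ X) (small : ∀ {x} → x ∈ X → ¬ Unbounded κ (neighbours X x)) where

          Bound : Carrier → Carrier → Set ℓ
          Bound x ξ = ∀ y → y ∈ X → ⟨ x , y ⟩ ∈ E → ξ ∉ y

          leastBound : ∃[ b ] Fun b greedy κ × (∀ {x} → x ∈ greedy → Bound x (b · x))
          leastBound = b , B , λ x∈ → proj₁ (rel⁻ (·-graph B x∈))
            where
            b = rel greedy κ λ x ξ → Bound x ξ × (∀ ζ → ζ ∈ ξ → ¬ Bound x ζ)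

            B : Fun b greedy κ
            B = relFun
              (λ {x} x∈ → let (β , β∈κ , bound) = ¬unbounded⇒bounded (small (greedy⊆ x∈))
                          in least (K .ord) (λ ξ → ∀ y → y ∈ X → ⟨ x , y ⟩ ∈ E → ξ ∉ y)
                                   (β , β∈κ , λ y y∈X adj → bound (from ∈-neighbours (y∈X , adj))))
              (λ {x} _ → least-unique (K .ord) {Bound x})

          greedy-unbounded : Unbounded κ greedy
          greedy-unbounded = byContradiction λ ¬unb → contradiction leastBound (¬unbounded⇒bounded ¬unb)
            where
            contradiction : (∃[ b ] Fun b greedy κ × (∀ {x} → x ∈ greedy → Bound x (b · x))) →
                            ¬ (∃[ β ] β ∈ κ × (∀ {x} → x ∈ greedy → β ∉ x))
            contradiction (b , B , bound) (β , β∈κ , β-bound) =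
              escape (¬unbounded⇒bounded (reg {range b greedy κ} sep⊆ range-countable))
              where
              range-countable : range b greedy κ ≾ ω
              range-countable = ≾-trans (range-≾ (K .ord) (λ p → X⊆κ (greedy⊆ p)) B)
                                        (bounded⇒countable (λ p → X⊆κ (greedy⊆ p)) β∈κ β-bound)

              escape : ¬ (∃[ δ ] δ ∈ κ × (∀ {r} → r ∈ range b greedy κ → δ ∉ r))
              escape (δ , δ∈κ , δ-bound)
                with α , α∈X , β∈α , δ∈α ← above-both X⊆κ unb β∈κ δ∈κ
                with γ , γ∈ , adj ← greedy-maximal α∈X (λ α∈ → β-bound α∈ β∈α) =
                bound γ∈ α α∈X adj b·γ∈α
                where
                b·γ∈α : b · γ ∈ α
                b·γ∈α with K .ord .compare (·-cod B γ∈) δ∈κ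
                ... | inj₁ b·γ∈δ = ∈-ord (K .ord) (X⊆κ α∈X) .transitive b·γ∈δ δ∈α
                ... | inj₂ (inj₁ e) = subst (_∈ α) (sym e) δ∈α
                ... | inj₂ (inj₂ δ∈b·γ) = ⊥-elim (δ-bound (sep⁺ (·-cod B γ∈) (γ , γ∈ , refl)) δ∈b·γ)

      -- One vertex after another is chosen with an unbounded neighbourhood inside the common
      -- neighbourhood of its predecessors.
      module Clique {U : Carrier} (U⊆κ : U ⊆′ κ) (unb : Unbounded κ U)
        (large : ∀ {X} → X ⊆′ U → Unbounded κ X →
                 ∃[ x ] x ∈ X × Unbounded κ (neighbours X x)) where

        opaque
          unboundedSets : Carrier
          unboundedSets = sep (λ X → ∀ β → β ∈ κ → ∃[ x ] x ∈ X × β ∈ x) (𝒫 U)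

          unboundedSets⁺ : ∀ {X} → X ⊆′ U → Unbounded κ X → X ∈ unboundedSets
          unboundedSets⁺ X⊆U u = sep⁺ (from ∈-𝒫 X⊆U) u

          unboundedSets⊆ : ∀ {X} → X ∈ unboundedSets → X ⊆′ U
          unboundedSets⊆ p = to ∈-𝒫 (sep⊆ p)

          unboundedSets⁻ : ∀ {X} → X ∈ unboundedSets → Unbounded κ X
          unboundedSets⁻ = sep⁻

        Large : Carrier → Carrier → Set ℓ
        Large X x = x ∈ X × (∀ β → β ∈ κ → ∃[ y ] (y ∈ X × ⟨ x , y ⟩ ∈ E) × β ∈ y)

        choosing : ∃[ p ] Fun p unboundedSets κ × (∀ {X} → X ∈ unboundedSets → Large X (p · X))
        choosing = p , P , λ X∈ → proj₁ (rel⁻ (·-graph P X∈))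
          where
          p = rel unboundedSets κ λ X x → Large X x × (∀ z → z ∈ x → ¬ Large X z)

          P : Fun p unboundedSets κ
          P = relFun
            (λ {X} X∈ → let (x , x∈X , u) = large (unboundedSets⊆ X∈) (unboundedSets⁻ X∈) in
              least (K .ord) (λ x → x ∈ X × (∀ β → β ∈ κ → ∃[ y ] (y ∈ X × ⟨ x , y ⟩ ∈ E) × β ∈ y))
                (x , U⊆κ (unboundedSets⊆ X∈ x∈X) , x∈X , λ β β∈κ →
                  let (y , y∈ , β∈y) = u β β∈κ in y , to ∈-neighbours y∈ , β∈y))
            (λ {X} _ → least-unique (K .ord) {Large X})

        module _ {p : Carrier} (p-large : ∀ {X} → X ∈ unboundedSets → Large X (p · X)) where

          -- This is `Y ≡ neighbours X (p · X)`, spelled out by membership so that instance search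
          -- finds it definable.
          Shrinks : Carrier → Carrier → Set ℓ
          Shrinks X Y = ∀ y → (y ∈ Y → y ∈ X × ⟨ p · X , y ⟩ ∈ E) × (y ∈ X × ⟨ p · X , y ⟩ ∈ E → y ∈ Y)

          shrinking : ∃[ F ] Fun F unboundedSets unboundedSets
                           × (∀ {X} → X ∈ unboundedSets → Shrinks X (F · X))
          shrinking = F , step , λ X∈ → rel⁻ (·-graph step X∈)
            where
            F = rel unboundedSets unboundedSets Shrinks

            step : Fun F unboundedSets unboundedSets
            step = relFun
              (λ {X} X∈ → neighbours X (p · X) ,
                unboundedSets⁺ (λ y∈ → unboundedSets⊆ X∈ (proj₁ (to ∈-neighbours y∈)))
                  (λ β β∈κ → let (y , y∈ , β∈y) = proj₂ (p-large X∈) β β∈κ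
                              in y , from ∈-neighbours y∈ , β∈y) ,
                λ y → to ∈-neighbours , from ∈-neighbours)
              (λ _ _ _ s s′ → ⊆-antisym (λ y∈ → proj₂ (s′ _) (proj₁ (s _) y∈))
                                        (λ y∈ → proj₂ (s _) (proj₁ (s′ _) y∈)))

          module _ {h : Carrier} (H : Fun h ω unboundedSets)
                   (shrinks : ∀ {n} → n ∈ ω → Shrinks (h · n) (h · (n ⁺))) where

            -- The sets `h · n` decrease, so `u` has passed through every earlier neighbourhood. The
            -- claim covers all elements of `h · n` because the vertex chosen there need not survive
            -- to the next stage.
            adjacent-to-later : ∀ {n} → n ∈ ω → ∀ m u → m ∈ n → u ∈ h · n → ⟨ p · (h · m) , u ⟩ ∈ E
            adjacent-to-later = ω-induction (λ n → ∀ m u → m ∈ n → u ∈ h · n → ⟨ p · (h · m) , u ⟩ ∈ E)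
              (λ _ _ m∈∅ → ⊥-elim (∉∅ m∈∅))
              λ n∈ω ih m u m∈n⁺ u∈ → let (u∈h·n , adj) = proj₁ (shrinks n∈ω u) u∈ in
                [ (λ m∈n → ih m u m∈n u∈h·n) , (λ { refl → adj }) ] (to ∈-⁺ m∈n⁺)

            chosen : ∀ {n} → n ∈ ω → p · (h · n) ∈ h · n
            chosen n∈ω = proj₁ (p-large (·-cod H n∈ω))

            chosen-adjacent : ∀ {m n} → m ∈ ω → n ∈ ω → m ≢ n → ⟨ p · (h · m) , p · (h · n) ⟩ ∈ E
            chosen-adjacent m∈ω n∈ω m≢n with ω-ord .compare m∈ω n∈ω
            ... | inj₁ m∈n = adjacent-to-later n∈ω _ _ m∈n (chosen n∈ω)
            ... | inj₂ (inj₁ m≡n) = ⊥-elim (m≢n m≡n)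
            ... | inj₂ (inj₂ n∈m) = E-sym (adjacent-to-later m∈ω _ _ n∈m (chosen m∈ω))

            chosen-clique : ∃[ c ] Inj c ω U × (∀ {m n} → m ∈ ω → n ∈ ω → m ≢ n → ⟨ c · m , c · n ⟩ ∈ E)
            chosen-clique = c , C , λ m∈ω n∈ω m≢n →
              subst₂ (λ x y → ⟨ x , y ⟩ ∈ E) (sym (c· m∈ω)) (sym (c· n∈ω)) (chosen-adjacent m∈ω n∈ω m≢n)
              where
              c = rel ω U λ n x → x ≡ p · (h · n)

              chosen∈U : ∀ {n} → n ∈ ω → p · (h · n) ∈ U
              chosen∈U n∈ω = unboundedSets⊆ (·-cod H n∈ω) (chosen n∈ω)

              C : Inj c ω U
              C = relInj (λ n∈ω → _ , chosen∈U n∈ω , refl) (λ { _ _ _ refl refl → refl })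
                -- Vertices chosen at different stages are adjacent, so equal ones would form a
                -- loop.
                (λ { m∈ω n∈ω _ refl e → byContradiction λ m≢n →
                     E-irrefl (subst (λ y → ⟨ _ , y ⟩ ∈ E) (sym e) (chosen-adjacent m∈ω n∈ω m≢n)) })

              c· : ∀ {n} → n ∈ ω → c · n ≡ p · (h · n)
              c· n∈ω = ·-value (C .fun) (rel⁺ n∈ω (chosen∈U n∈ω) refl)

        clique : ∃[ c ] Inj c ω U × (∀ {m n} → m ∈ ω → n ∈ ω → m ≢ n → ⟨ c · m , c · n ⟩ ∈ E)
        clique = iterate choosing
          where
          iterate : (∃[ p ] Fun p unboundedSets κ × (∀ {X} → X ∈ unboundedSets → Large X (p · X))) →
                    ∃[ c ] Inj c ω U × (∀ {m n} → m ∈ ω → n ∈ ω → m ≢ n → ⟨ c · m , c · n ⟩ ∈ E)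
          iterate (p , _ , p-large) =
            let (F , step , shrinks) = shrinking p-large
                (h , H , _ , h-⁺) = recursion step (unboundedSets⁺ id unb)
            in chosen-clique p-large H λ {n} n∈ω →
                 subst (Shrinks p-large (h · n)) (sym (h-⁺ n∈ω)) (shrinks (·-cod H n∈ω))

      partition : ∀ {U} → U ⊆′ κ → Unbounded κ U →
        (∃[ S ] S ⊆′ U × Unbounded κ S × Independent S)
        ⊎ (∃[ c ] Inj c ω U × (∀ {m n} → m ∈ ω → n ∈ ω → m ≢ n → ⟨ c · m , c · n ⟩ ∈ E))
      partition {U} U⊆κ unb
        with em {∃[ X ] X ⊆′ U × Unbounded κ X
                        × (∀ {x} → x ∈ X → ¬ Unbounded κ (neighbours X x))}
      ... | yes (X , X⊆U , unb-X , small) =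
        inj₁ (greedy , (λ p → X⊆U (greedy⊆ p)) , greedy-unbounded unb-X small , greedy-independent)
        where open GreedyIndependent (λ {x} p → U⊆κ (X⊆U p))
      ... | no ¬ex = inj₂ (Clique.clique U⊆κ unb λ X⊆U unb-X → byContradiction λ ¬large →
        ¬ex (_ , X⊆U , unb-X , λ x∈X u → ¬large (_ , x∈X , u)))

-- Transfer from graphs on ℵ₁ to colourings of `V`.

module Transfer {ℓ : Level} (em : ExcludedMiddle ℓ) (𝕍 : Structure ℓ) (zf : IsZF 𝕍) where
  open Structure 𝕍
  open Definability 𝕍
  open SetTheory em 𝕍 zf
  open Ordinals em 𝕍 zf
  open Countability em 𝕍 zf
  open Regularity em 𝕍 zf
  open Partition em 𝕍 zf
  open Fun
  open Inj
  open Aleph₁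

  opaque
    one : Carrier
    one = ∅ ⁺

    isOne⇔ : ∀ {i} → IsOne 𝕍 i ⇔ i ≡ one
    isOne⇔ = ≡⇔ext (mk⇔ (λ p → from isEmpty⇔ ([ (λ q → ⊥-elim (∉∅ q)) , id ]′ (to ∈-⁺ p)))
                        (λ e → from ∈-⁺ (inj₂ (to isEmpty⇔ e))))

  image-≾ : ∀ {j U V S} → Inj j U V → S ⊆′ U → S ≾ range j S V
  image-≾ {j} {S = S} J S⊆U = rel S (range j S _) (λ x v → v ≡ j · x) ,
    relInj (λ x∈S → _ , sep⁺ (·-cod (J .fun) (S⊆U x∈S)) (_ , x∈S , refl) , refl)
           (λ { _ _ _ refl refl → refl })
           (λ { p q _ refl e → ·-injective J (S⊆U p) (S⊆U q) e })

  color : ∀ {f V x y} → IsColoring 𝕍 f V → x ∈ V → y ∈ V → x ≢ y →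
          ⟨ ｛ x , y ｝ , ∅ ⟩ ∈ f ⊎ ⟨ ｛ x , y ｝ , one ⟩ ∈ f
  color {f} {V} {x} {y} (D , T , D-pairs , T-colors , isF) x∈V y∈V x≢y =
    [ (λ z → inj₁ (value (to isEmpty⇔ z))) , (λ o → inj₂ (value (to isOne⇔ o))) ]
      (to (T-colors _) (·-cod F p∈D))
    where
    F = to isFunction⇔ isF

    p∈D : ｛ x , y ｝ ∈ D
    p∈D = from (D-pairs _) (x , y , x∈V , y∈V , x≢y , from isPair⇔ refl)

    value : ∀ {i} → f · ｛ x , y ｝ ≡ i → ⟨ ｛ x , y ｝ , i ⟩ ∈ f
    value e = subst (λ i → ⟨ _ , i ⟩ ∈ f) e (·-graph F p∈D)

  Homogeneous : Carrier → Carrier → Set ℓ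
  Homogeneous V f =
    (∃[ S ] ∃[ i ] _⊆_ 𝕍 S V × Uncountable 𝕍 S × IsZero 𝕍 i × IsMonochromatic 𝕍 f S i)
    ⊎ (∃[ S ] ∃[ i ] _⊆_ 𝕍 S V × CountablyInfinite 𝕍 S × IsOne 𝕍 i × IsMonochromatic 𝕍 f S i)

  module _ {κ : Carrier} (K : Aleph₁ κ) (reg : Regular κ) {V f : Carrier} (col : IsColoring 𝕍 f V) where

    module _ {U j : Carrier} (U⊆κ : U ⊆′ κ) (J : Inj j U V) where

      edges : Carrier
      edges = rel κ κ λ α β → (α ∈ U × β ∈ U × α ≢ β) × ⟨ ｛ j · α , j · β ｝ , one ⟩ ∈ f

      edges⁺ : ∀ {α β} → α ∈ U → β ∈ U → α ≢ β → ⟨ ｛ j · α , j · β ｝ , one ⟩ ∈ f → ⟨ α , β ⟩ ∈ edges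
      edges⁺ p q ne h = rel⁺ (U⊆κ p) (U⊆κ q) ((p , q , ne) , h)

      edges⁻ : ∀ {α β} → ⟨ α , β ⟩ ∈ edges →
               (α ∈ U × β ∈ U × α ≢ β) × ⟨ ｛ j · α , j · β ｝ , one ⟩ ∈ f
      edges⁻ = rel⁻

      edges-sym : ∀ {α β} → ⟨ α , β ⟩ ∈ edges → ⟨ β , α ⟩ ∈ edges
      edges-sym e = let ((p , q , ne) , h) = edges⁻ e in
        edges⁺ q p (≢-sym ne) (subst (λ u → ⟨ u , one ⟩ ∈ f) pair-comm h)

      edges-irrefl : ∀ {α} → ⟨ α , α ⟩ ∉ edges
      edges-irrefl e = proj₂ (proj₂ (proj₁ (edges⁻ e))) refl

      independent⇒Homogeneous : ∀ {S} → S ⊆′ U → Unbounded κ S →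
                                (∀ x y → x ∈ S → y ∈ S → ⟨ x , y ⟩ ∉ edges) → Homogeneous V f
      independent⇒Homogeneous {S} S⊆U unb ind = inj₁
        ( range j S V , ∅ , (λ _ → sep⊆)
        -- A countable image would make `S` countable as well as unbounded, which regularity
        -- excludes.
        , (λ c → reg (λ p → U⊆κ (S⊆U p)) (≾-trans (image-≾ J S⊆U) (to countable⇔ c)) unb)
        , from isEmpty⇔ refl , λ v w v∈ w∈ → mono v w (sep⁻ v∈) (sep⁻ w∈) )
        where
        mono : ∀ v w → (∃[ x ] x ∈ S × v ≡ j · x) → (∃[ y ] y ∈ S × w ≡ j · y) → v ≢ w →
               ∃[ p ] IsPair 𝕍 p v w × Related 𝕍 f p ∅
        mono _ _ (x , x∈S , refl) (y , y∈S , refl) ne = _ , from isPair⇔ refl , from related⇔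
          ([ id , (λ h → ⊥-elim (ind x y x∈S y∈S (edges⁺ (S⊆U x∈S) (S⊆U y∈S) (λ { refl → ne refl }) h))) ]′
            (color col (·-cod (J .fun) (S⊆U x∈S)) (·-cod (J .fun) (S⊆U y∈S)) ne))

      clique⇒Homogeneous : ∀ {c} → Inj c ω U →
                           (∀ {m n} → m ∈ ω → n ∈ ω → m ≢ n → ⟨ c · m , c · n ⟩ ∈ edges) → Homogeneous V f
      clique⇒Homogeneous {c} C adj = inj₂
        ( range g ω V , one , (λ _ → sep⊆) , (ω , from isOmega⇔ refl , enumeration (converse G))
        , from isOne⇔ refl , λ v w v∈ w∈ → mono v w (sep⁻ v∈) (sep⁻ w∈) )
        where
        g = rel ω V λ n v → v ≡ j · (c · n)

        c∈U : ∀ {n} → n ∈ ω → c · n ∈ U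
        c∈U = ·-cod (C .fun)

        G : Inj g ω V
        G = relInj (λ p → _ , ·-cod (J .fun) (c∈U p) , refl) (λ { _ _ _ refl refl → refl })
                   (λ { p q _ refl e → ·-injective C p q (·-injective J (c∈U p) (c∈U q) e) })

        g· : ∀ {n} → n ∈ ω → g · n ≡ j · (c · n)
        g· p = ·-value (G .fun) (rel⁺ p (·-cod (J .fun) (c∈U p)) refl)

        enumeration : (∃[ e ] Inj e (range g ω V) ω × (∀ {x} → x ∈ ω → ⟨ g · x , x ⟩ ∈ e)
                                                    × (∀ {x y} → ⟨ y , x ⟩ ∈ e → y ≡ g · x)) →
                      ∃[ e ] IsBijection 𝕍 e (range g ω V) ω
        enumeration (e , I , onto , _) = e , from isInjection⇔ I , λ n p → g · n , from related⇔ (onto p)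

        mono : ∀ v w → (∃[ m ] m ∈ ω × v ≡ g · m) → (∃[ n ] n ∈ ω × w ≡ g · n) → v ≢ w →
               ∃[ p ] IsPair 𝕍 p v w × Related 𝕍 f p one
        mono _ _ (m , p , refl) (n , q , refl) ne = _ , from isPair⇔ refl , from related⇔
          (subst₂ (λ v w → ⟨ ｛ v , w ｝ , one ⟩ ∈ f) (sym (g· p)) (sym (g· q))
            (proj₂ (edges⁻ (adj p q λ { refl → ne refl }))))

      homogeneous : Unbounded κ U → Homogeneous V f
      homogeneous unb =
        [ (λ (S , S⊆U , unb-S , ind) → independent⇒Homogeneous S⊆U unb-S ind)
        , (λ (c , C , adj) → clique⇒Homogeneous C adj) ]
        (partition K reg edges-sym edges-irrefl U⊆κ unb)

    κ≾⇒homogeneous : κ ≾ V → Homogeneous V f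
    κ≾⇒homogeneous (j , J) = homogeneous id J (uncountable⇒unbounded K reg id (K .uncountable))

    -- `U` is the image of `V` in κ, sent back to `V` by the converse injection. It is as
    -- uncountable as `V`, and bounded subsets of κ are countable, so it is unbounded.
    ≾κ⇒homogeneous : ¬ V ≾ ω → V ≾ κ → Homogeneous V f
    ≾κ⇒homogeneous unc (j , J) =
      let (g , G , _) = converse J
      in homogeneous sep⊆ G (uncountable⇒unbounded K reg sep⊆ λ h → unc (≾-trans (image-≾ J id) h))

  DC⇒EDM : DC-ℵ₁ 𝕍 → EDM 𝕍
  DC⇒EDM dc V _ _ unc f col =
    let (κ , K) = aleph₁-exists
    in κ≾⇒homogeneous K (dc-regular dc K) col (dc-≾ dc K λ h → unc (from countable⇔ h))

  W⇒EDM : W-ℵ₁ 𝕍 → ℵ₁-regular 𝕍 → EDM 𝕍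
  W⇒EDM w reg V _ _ unc f col =
    let (κ , K) = aleph₁-exists
        reg′ = ℵ₁-regular⇒Regular reg K
    in [ (λ V≼κ → ≾κ⇒homogeneous K reg′ col (λ h → unc (from countable⇔ h)) (to ≼⇔ V≼κ))
       , (λ κ≼V → κ≾⇒homogeneous K reg′ col (to ≼⇔ κ≼V)) ]
       (w κ (from isAleph₁⇔ K) V)

theorem4p1 : ∀ {ℓ} → ExcludedMiddle ℓ → (𝕍 : Structure ℓ) → IsZF 𝕍 →
    (DC-ℵ₁ 𝕍 → EDM 𝕍) × (W-ℵ₁ 𝕍 × ℵ₁-regular 𝕍 → EDM 𝕍)
theorem4p1 em 𝕍 zf = DC⇒EDM , λ (w , reg) → W⇒EDM w reg
  where open Transfer em 𝕍 zf
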